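{- Let $a\ge1$. Then: (1) For any two permutations $\nu,\nu'$ of $[a]$, $\mathcal{T}_\nu$ and $\mathcal{T}_{\nu'}$ acting on $J(\mathcal{L}_a)$ have the same orbit structure (the same multiset of orbit sizes). (2) For $1\le j\le a$ let $s_j(I)=\#\{i\in[a]: |C_i(I)|=j\}$. For every permutation $\nu$ of $[a]$ and every $1\le j\le a$, $s_j$ is homomesic for $\mathcal{T}_\nu$ on $J(\mathcal{L}_a)$, and its average along every orbit is the same for all $j$ (namely $1/2$). Consequently every real linear combination of the $s_j$ is homomesic for $\mathcal{T}_\nu$ on $J(\mathcal{L}_a)$.
   Context: For a finite poset $P$, $J(P)$ is the set of order ideals (down-closed subsets) of $P$. For $x\in P$, the toggle $\sigma_x:J(P)\to J(P)$ is $\sigma_x(I)=I\cup\{x\}$ if $x\notin I$ and $I\cup\{x\}\in J(P)$; $\sigma_x(I)=I\setminus\{x\}$ if $x\in I$ and $I\setminus\{x\}\in J(P)$; $\sigma_x(I)=I$ otherwise. For a chain $C=\{x_1<\dots<x_m\}$ in $P$, $\sigma_C=\sigma_{x_1}\circ\cdots\circ\sigma_{x_m}$ (largest element toggled first). $\mathcal{L}_a=\{(i,j)\in[a]\times[a]: i\le j\}$ with the order $(i_1,j_1)\le(i_2,j_2)$ iff $i_1\le i_2$ and $j_1\le j_2$; its columns are $C_c=\{(c,j): c\le j\le a\}$ for $c\in[a]$, and $C_c(I)=C_c\cap I$. For a permutation $\nu$ of $[a]$, comotion is $\mathcal{T}_\nu=\sigma_{C_{\nu(a)}}\circ\cdots\circ\sigma_{C_{\nu(1)}}$.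 A function $f$ on a finite set with a permutation $\tau$ is homomesic if its average over every $\tau$-orbit is the same constant. -}

module Defs where

open import Data.Bool.Base using (Bool; true; false)
import Data.Bool.Properties as Bool
open import Data.Fin.Base as Fin using (Fin; toℕ)
import Data.Fin.Properties as Fin
open import Data.Fin.Permutation using (Permutation′; _⟨$⟩ʳ_)
open import Data.Fin.Subset using (Subset; inside; outside; ⁅_⁆; _∪_; _-_) renaming (_∈_ to _∈ₛ_; _∉_ to _∉ₛ_)
open import Data.Fin.Subset.Properties using (_∈?_; x∈⁅x⁆; x∈⁅y⁆⇒x≡y; x∈p∪q⁻; x∈p∪q⁺; x∈p∧x≢y⇒x∈p-y; p─q⊆p; p─q─q≡p─q; x∈p⇒p-x⊂p; ⊆-antisym)
import Data.Integer.Base as ℤ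
open import Data.Irrelevant using ([_])
open import Data.List.Base using (List; []; _∷_; map; filter; length; foldr; foldl; allFin; iterate; deduplicate; cartesianProduct; cartesianProductWith)
open import Data.List.Membership.Propositional using (_∈_)
open import Data.List.Membership.Propositional.Properties using (∈-allFin; ∈-cartesianProduct⁺; ∈-cartesianProductWith⁺; ∈-filter⁺; ∈-map⁻)
import Data.List.Membership.DecPropositional as DecMembership
import Data.List.Relation.Unary.All as All
open import Data.List.Relation.Unary.AllPairs as AllPairs using (AllPairs; []; _∷_)
import Data.List.Relation.Unary.AllPairs.Properties as AllPairs
open import Data.List.Relation.Unary.Any as Any using (here; there)
open import Data.List.Relation.Unary.Enumerates.Setoid using (IsEnumeration)
open import Data.List.Relation.Unary.Unique.Propositional using (Unique)
import Data.List.Relation.Unary.Unique.Propositional.Properties as Unique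
open import Data.Nat.Base as ℕ using (ℕ; zero; suc)
import Data.Nat.Properties as ℕ
open import Data.Product.Base using (∃-syntax; _×_; _,_; proj₁; proj₂)
open import Data.Product.Properties using (≡-dec)
open import Data.Rational.Base as ℚ using (ℚ; 0ℚ; 1ℚ; ½; ∣_∣)
import Data.Rational.Properties as ℚ
open import Data.Rational.Solver using (module +-*-Solver)
open import Data.Refinement.Base using (Refinement-syntax; _,_; value)
open import Data.Refinement.Properties using (value-injective) renaming (_≟_ to ≟-refinement)
open import Data.Sum.Base using (inj₁; inj₂)
open import Data.Vec.Base using ([]; _∷_)
import Data.Vec.Properties as Vec
open import Function.Base using (_∘_)
open import Function.Bundles using (_↔_; mk↔ₛ′; module Inverse)
open import Function.Construct.Composition using (_↔-∘_)
open import Function.Construct.Identity using (↔-id)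
open import Level using (0ℓ)
open import Relation.Binary.Core using (Rel)
open import Relation.Binary.Definitions using (DecidableEquality)
open import Relation.Binary.PropositionalEquality using (_≡_; _≢_; refl; sym; trans; cong; cong₂; subst; setoid; isEquivalence)
open import Relation.Binary.Structures using (IsDecPartialOrder)
open import Relation.Nullary using (¬_; Dec; yes; no; contradiction; recompute)
open import Relation.Nullary.Decidable using (map′; _→-dec_; _×-dec_)
open import Relation.Unary using (Pred; Decidable)

------------------------------------------------------------------------
-- Real numbers: Cauchy sequences of rationals, with all operations
-- pointwise, up to the equivalence _≃_ (difference tends to 0).

private
  half+half : ∀ ε → ½ ℚ.* ε ℚ.+ ½ ℚ.* ε ≡ ε
  half+half ε = trans (sym (ℚ.*-distribʳ-+ ε ½ ½)) (ℚ.*-identityˡ ε)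

  half-pos : ∀ {ε} → 0ℚ ℚ.< ε → 0ℚ ℚ.< ½ ℚ.* ε
  half-pos {ε} 0<ε = subst (ℚ._< ½ ℚ.* ε) (ℚ.*-zeroʳ ½) (ℚ.*-monoʳ-<-pos ½ 0<ε)

record ℝ : Set where
  field
    seq    : ℕ → ℚ
    cauchy : ∀ ε → 0ℚ ℚ.< ε →
             ∃[ N ] (∀ m n → N ℕ.≤ m → N ℕ.≤ n → ∣ seq m ℚ.- seq n ∣ ℚ.< ε)

open ℝ

infix 4 _≃_
_≃_ : Rel ℝ 0ℓ
x ≃ y = ∀ ε → 0ℚ ℚ.< ε →
        ∃[ N ] (∀ n → N ℕ.≤ n → ∣ seq x n ℚ.- seq y n ∣ ℚ.< ε)

fromℚ : ℚ → ℝ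
fromℚ q .seq _ = q
fromℚ q .cauchy ε 0<ε =
  0 , λ _ _ _ _ → subst (λ r → ∣ r ∣ ℚ.< ε) (sym (ℚ.+-inverseʳ q)) 0<ε

fromℕ : ℕ → ℝ
fromℕ n = fromℚ (ℤ.+ n ℚ./ 1)

infixl 6 _+_
_+_ : ℝ → ℝ → ℝ
(x + y) .seq n = seq x n ℚ.+ seq y n
(x + y) .cauchy ε 0<ε
  with N₁ , x-close ← cauchy x (½ ℚ.* ε) (half-pos 0<ε)
     | N₂ , y-close ← cauchy y (½ ℚ.* ε) (half-pos 0<ε) =
  N₁ ℕ.⊔ N₂ , λ m n m≥ n≥ → begin-strict
    ∣ (seq x m ℚ.+ seq y m) ℚ.- (seq x n ℚ.+ seq y n) ∣
      ≡⟨ cong ∣_∣ (rearrange (seq x m) (seq y m) (seq x n) (seq y n)) ⟩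
    ∣ (seq x m ℚ.- seq x n) ℚ.+ (seq y m ℚ.- seq y n) ∣
      ≤⟨ ℚ.∣p+q∣≤∣p∣+∣q∣ (seq x m ℚ.- seq x n) (seq y m ℚ.- seq y n) ⟩
    ∣ seq x m ℚ.- seq x n ∣ ℚ.+ ∣ seq y m ℚ.- seq y n ∣
      <⟨ ℚ.+-mono-< (x-close m n (ℕ.m⊔n≤o⇒m≤o N₁ N₂ m≥) (ℕ.m⊔n≤o⇒m≤o N₁ N₂ n≥))
                    (y-close m n (ℕ.m⊔n≤o⇒n≤o N₁ N₂ m≥) (ℕ.m⊔n≤o⇒n≤o N₁ N₂ n≥)) ⟩
    ½ ℚ.* ε ℚ.+ ½ ℚ.* ε
      ≡⟨ half+half ε ⟩
    ε ∎
  where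
  open ℚ.≤-Reasoning
  rearrange : ∀ p q r s → (p ℚ.+ q) ℚ.- (r ℚ.+ s) ≡ (p ℚ.- r) ℚ.+ (q ℚ.- s)
  rearrange = solve 4 (λ p q r s → (p :+ q) :- (r :+ s) := (p :- r) :+ (q :- s)) refl
    where open +-*-Solver

private
  eventually-bounded : (x : ℝ) → ∃[ B ] (0ℚ ℚ.< B × ∃[ N ] (∀ n → N ℕ.≤ n → ∣ seq x n ∣ ℚ.≤ B))
  eventually-bounded x with N , close ← cauchy x 1ℚ (ℚ.positive⁻¹ 1ℚ) =
    ∣ seq x N ∣ ℚ.+ 1ℚ ,
    ℚ.+-mono-≤-< (ℚ.0≤∣p∣ (seq x N)) (ℚ.positive⁻¹ 1ℚ) ,
    N , λ n n≥ → begin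
      ∣ seq x n ∣
        ≡⟨ cong ∣_∣ (split (seq x n) (seq x N)) ⟩
      ∣ seq x N ℚ.+ (seq x n ℚ.- seq x N) ∣
        ≤⟨ ℚ.∣p+q∣≤∣p∣+∣q∣ (seq x N) (seq x n ℚ.- seq x N) ⟩
      ∣ seq x N ∣ ℚ.+ ∣ seq x n ℚ.- seq x N ∣
        ≤⟨ ℚ.+-monoʳ-≤ ∣ seq x N ∣ (ℚ.<⇒≤ (close n N n≥ ℕ.≤-refl)) ⟩
      ∣ seq x N ∣ ℚ.+ 1ℚ ∎
    where
    open ℚ.≤-Reasoning
    split : ∀ p q → p ≡ q ℚ.+ (p ℚ.- q)
    split = solve 2 (λ p q → p := q :+ (p :- q)) refl
      where open +-*-Solver

  scale-down : ∀ B ε → 0ℚ ℚ.< B → 0ℚ ℚ.< ε → ∃[ δ ] (0ℚ ℚ.< δ × B ℚ.* δ ≡ ε)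
  scale-down B ε 0<B 0<ε = B⁻¹ ℚ.* ε , pos , eq
    where
    instance
      B>0 : ℚ.Positive B
      B>0 = ℚ.positive 0<B
      B≢0 : ℚ.NonZero B
      B≢0 = ℚ.pos⇒nonZero B
    B⁻¹ : ℚ
    B⁻¹ = ℚ.1/ B
    instance
      B⁻¹>0 : ℚ.Positive B⁻¹
      B⁻¹>0 = ℚ.1/pos⇒pos B
    pos : 0ℚ ℚ.< B⁻¹ ℚ.* ε
    pos = subst (ℚ._< B⁻¹ ℚ.* ε) (ℚ.*-zeroʳ B⁻¹) (ℚ.*-monoʳ-<-pos B⁻¹ 0<ε)
    eq : B ℚ.* (B⁻¹ ℚ.* ε) ≡ ε
    eq = trans (sym (ℚ.*-assoc B B⁻¹ ε))
               (trans (cong (ℚ._* ε) (ℚ.*-inverseʳ B)) (ℚ.*-identityˡ ε))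

  *-bound : ∀ {p q B δ} → 0ℚ ℚ.< B → ∣ p ∣ ℚ.≤ B → ∣ q ∣ ℚ.< δ → ∣ p ℚ.* q ∣ ℚ.< B ℚ.* δ
  *-bound {p} {q} {B} {δ} 0<B p≤B q<δ = begin-strict
    ∣ p ℚ.* q ∣     ≡⟨ ℚ.∣p*q∣≡∣p∣*∣q∣ p q ⟩
    ∣ p ∣ ℚ.* ∣ q ∣ ≤⟨ ℚ.*-monoʳ-≤-nonNeg ∣ q ∣ {{ℚ.∣-∣-nonNeg q}} p≤B ⟩
    B ℚ.* ∣ q ∣     <⟨ ℚ.*-monoʳ-<-pos B {{ℚ.positive 0<B}} q<δ ⟩
    B ℚ.* δ         ∎
    where open ℚ.≤-Reasoning

  *-difference : ∀ p q r s → p ℚ.* q ℚ.- r ℚ.* s ≡ p ℚ.* (q ℚ.- s) ℚ.+ s ℚ.* (p ℚ.- r)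
  *-difference = solve 4 (λ p q r s → p :* q :- r :* s := p :* (q :- s) :+ s :* (p :- r)) refl
    where open +-*-Solver

  *-close : ∀ p q r s {X Y δ₁ δ₂ ε} → 0ℚ ℚ.< X → 0ℚ ℚ.< Y →
            X ℚ.* δ₁ ≡ ½ ℚ.* ε → Y ℚ.* δ₂ ≡ ½ ℚ.* ε →
            ∣ p ∣ ℚ.≤ X → ∣ s ∣ ℚ.≤ Y → ∣ q ℚ.- s ∣ ℚ.< δ₁ → ∣ p ℚ.- r ∣ ℚ.< δ₂ →
            ∣ p ℚ.* q ℚ.- r ℚ.* s ∣ ℚ.< ε
  *-close p q r s {X} {Y} {δ₁} {δ₂} {ε} 0<X 0<Y Xδ₁ Yδ₂ p≤X s≤Y q-s p-r = begin-strict
    ∣ p ℚ.* q ℚ.- r ℚ.* s ∣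
      ≡⟨ cong ∣_∣ (*-difference p q r s) ⟩
    ∣ p ℚ.* (q ℚ.- s) ℚ.+ s ℚ.* (p ℚ.- r) ∣
      ≤⟨ ℚ.∣p+q∣≤∣p∣+∣q∣ (p ℚ.* (q ℚ.- s)) (s ℚ.* (p ℚ.- r)) ⟩
    ∣ p ℚ.* (q ℚ.- s) ∣ ℚ.+ ∣ s ℚ.* (p ℚ.- r) ∣
      <⟨ ℚ.+-mono-< (*-bound {p} {q ℚ.- s} 0<X p≤X q-s) (*-bound {s} {p ℚ.- r} 0<Y s≤Y p-r) ⟩
    X ℚ.* δ₁ ℚ.+ Y ℚ.* δ₂
      ≡⟨ cong₂ ℚ._+_ Xδ₁ Yδ₂ ⟩
    ½ ℚ.* ε ℚ.+ ½ ℚ.* ε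
      ≡⟨ half+half ε ⟩
    ε ∎
    where open ℚ.≤-Reasoning

infixl 7 _*_
_*_ : ℝ → ℝ → ℝ
(x * y) .seq n = seq x n ℚ.* seq y n
(x * y) .cauchy ε 0<ε =
  let X , 0<X , M₁ , x≤X = eventually-bounded x
      Y , 0<Y , M₂ , y≤Y = eventually-bounded y
      δ₁ , 0<δ₁ , Xδ₁ = scale-down X (½ ℚ.* ε) 0<X (half-pos 0<ε)
      δ₂ , 0<δ₂ , Yδ₂ = scale-down Y (½ ℚ.* ε) 0<Y (half-pos 0<ε)
      N₁ , y-close = cauchy y δ₁ 0<δ₁
      N₂ , x-close = cauchy x δ₂ 0<δ₂
      M = M₁ ℕ.⊔ M₂
      N = N₁ ℕ.⊔ N₂
  in M ℕ.⊔ N , λ m n m≥ n≥ →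
    let M≤m = ℕ.m⊔n≤o⇒m≤o M N m≥
        M≤n = ℕ.m⊔n≤o⇒m≤o M N n≥
        N≤m = ℕ.m⊔n≤o⇒n≤o M N m≥
        N≤n = ℕ.m⊔n≤o⇒n≤o M N n≥
    in *-close (seq x m) (seq y m) (seq x n) (seq y n) 0<X 0<Y Xδ₁ Yδ₂
         (x≤X m (ℕ.m⊔n≤o⇒m≤o M₁ M₂ M≤m))
         (y≤Y n (ℕ.m⊔n≤o⇒n≤o M₁ M₂ M≤n))
         (y-close m n (ℕ.m⊔n≤o⇒m≤o N₁ N₂ N≤m) (ℕ.m⊔n≤o⇒m≤o N₁ N₂ N≤n))
         (x-close m n (ℕ.m⊔n≤o⇒n≤o N₁ N₂ N≤m) (ℕ.m⊔n≤o⇒n≤o N₁ N₂ N≤n))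

sum : List ℝ → ℝ
sum = foldr _+_ (fromℚ 0ℚ)

-- Only ever applied to orbits, which are non-empty; the value at [] is junk.
average : List ℝ → ℝ
average []       = fromℚ 0ℚ
average (x ∷ xs) = fromℚ (ℤ.+ 1 ℚ./ length (x ∷ xs)) * sum (x ∷ xs)

------------------------------------------------------------------------
-- Finite sets

record Finite (A : Set) : Set where
  field
    _≟_      : DecidableEquality A
    elements : List A
    complete : IsEnumeration (setoid A) elements
    unique   : Unique elements

  size : ℕ
  size = length elements

  index : A → Fin size
  index x = Any.index (complete x)

  ∀? : {P : Pred A 0ℓ} → Decidable P → Dec (∀ x → P x)
  ∀? P? = map′ (λ ps x → All.lookup ps (complete x)) (λ p → All.universal p elements) (All.all? P? elements)

Fin-finite : ∀ n → Finite (Fin n)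
Fin-finite n = record
  { _≟_      = Fin._≟_
  ; elements = allFin n
  ; complete = ∈-allFin
  ; unique   = Unique.allFin⁺ n
  }

×-finite : ∀ {A B} → Finite A → Finite B → Finite (A × B)
×-finite FA FB = record
  { _≟_      = ≡-dec FA._≟_ FB._≟_
  ; elements = cartesianProduct FA.elements FB.elements
  ; complete = λ (x , y) → ∈-cartesianProduct⁺ (FA.complete x) (FB.complete y)
  ; unique   = Unique.cartesianProduct⁺ FA.unique FB.unique
  }
  where
  module FA = Finite FA
  module FB = Finite FB

Subset-finite : ∀ n → Finite (Subset n)
Subset-finite n = record
  { _≟_      = Vec.≡-dec Bool._≟_
  ; elements = subsets n
  ; complete = subsets-complete
  ; unique   = subsets-unique n
  }
  where
  sides : List Bool
  sides = inside ∷ outside ∷ []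

  subsets : ∀ n → List (Subset n)
  subsets zero    = [] ∷ []
  subsets (suc n) = cartesianProductWith _∷_ sides (subsets n)

  sides-complete : ∀ b → b ∈ sides
  sides-complete true  = here refl
  sides-complete false = there (here refl)

  subsets-complete : ∀ {n} (S : Subset n) → S ∈ subsets n
  subsets-complete []      = here refl
  subsets-complete (b ∷ S) = ∈-cartesianProductWith⁺ _∷_ (sides-complete b) (subsets-complete S)

  subsets-unique : ∀ n → Unique (subsets n)
  subsets-unique zero    = All.[] ∷ []
  subsets-unique (suc n) =
    Unique.cartesianProductWith⁺ _∷_ Vec.∷-injective
      (((λ ()) All.∷ All.[]) ∷ All.[] ∷ []) (subsets-unique n)

module _ {A : Set} {P : Pred A 0ℓ} (P? : Decidable P) where

  refineAll : List A → List [ x ∈ A ∣ P x ]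
  refineAll []       = []
  refineAll (x ∷ xs) with P? x
  ... | yes px = (x , [ px ]) ∷ refineAll xs
  ... | no  _  = refineAll xs

  map-value-refineAll : ∀ xs → map value (refineAll xs) ≡ filter P? xs
  map-value-refineAll []       = refl
  map-value-refineAll (x ∷ xs) with P? x
  ... | yes _ = cong (x ∷_) (map-value-refineAll xs)
  ... | no  _ = map-value-refineAll xs

  refinement-holds : (v : [ x ∈ A ∣ P x ]) → P (value v)
  refinement-holds (x , [ px ]) = recompute (P? x) px

  Refinement-finite : Finite A → Finite [ x ∈ A ∣ P x ]
  Refinement-finite FA = record
    { _≟_      = ≟-refinement FA._≟_
    ; elements = refineAll FA.elements
    ; complete = complete
    ; unique   = Unique.map⁻ (subst Unique (sym (map-value-refineAll FA.elements))
                                           (Unique.filter⁺ P? FA.unique))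
    }
    where
    module FA = Finite FA
    complete : ∀ v → v ∈ refineAll FA.elements
    complete v
      with w , w∈ , eq ← ∈-map⁻ value (subst (value v ∈_) (sym (map-value-refineAll FA.elements))
                                             (∈-filter⁺ P? (FA.complete (value v)) (refinement-holds v)))
      = subst (_∈ refineAll FA.elements) (sym (value-injective eq)) w∈

------------------------------------------------------------------------
-- Orbits of a permutation τ of a finite set, and homomesy

module _ {X : Set} (F : Finite X) (τ : X ↔ X) where
  open Finite F
  open DecMembership _≟_ using () renaming (_∈?_ to _∈ₗ?_)

  -- Every orbit has at most `size` elements, so the first `size` iterates
  -- exhaust it.
  orbit : X → List X
  orbit x = deduplicate _≟_ (iterate (Inverse.to τ) x size)

  orbitRepresentatives : List X
  orbitRepresentatives = deduplicate (λ x y → y ∈ₗ? orbit x) elements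

  -- A multiset is represented by a list, to be compared up to _↭_.
  orbitSizes : List ℕ
  orbitSizes = map (length ∘ orbit) orbitRepresentatives

  HomomesicWith : (X → ℝ) → ℝ → Set
  HomomesicWith f c = ∀ x → average (map f (orbit x)) ≃ c

  Homomesic : (X → ℝ) → Set
  Homomesic f = ∃[ c ] HomomesicWith f c

------------------------------------------------------------------------
-- Finite posets, order ideals and toggles

record FinitePoset : Set₁ where
  infix 4 _≤_ _<_
  field
    Carrier           : Set
    finite            : Finite Carrier
    _≤_               : Rel Carrier 0ℓ
    isDecPartialOrder : IsDecPartialOrder _≡_ _≤_

  open Finite finite public
  open IsDecPartialOrder isDecPartialOrder public using (_≤?_)

  _<_ : Rel Carrier 0ℓ
  x < y = x ≤ y × x ≢ y

private
  module _ {n : ℕ} where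

    i∉p-i : ∀ {i} (p : Subset n) → i ∉ₛ p - i
    i∉p-i {i} p i∈ with _ , j , j∈ , j∉ ← x∈p⇒p-x⊂p {p = p - i} i∈ =
      j∉ (subst (j ∈ₛ_) (sym (p─q─q≡p─q p ⁅ i ⁆)) j∈)

    add-remove : ∀ {i} {p : Subset n} → i ∉ₛ p → (p ∪ ⁅ i ⁆) - i ≡ p
    add-remove {i} {p} i∉p = ⊆-antisym fwd bwd
      where
      fwd : ∀ {j} → j ∈ₛ (p ∪ ⁅ i ⁆) - i → j ∈ₛ p
      fwd j∈ with x∈p∪q⁻ p ⁅ i ⁆ (p─q⊆p (p ∪ ⁅ i ⁆) ⁅ i ⁆ j∈)
      ... | inj₁ j∈p = j∈p
      ... | inj₂ j∈i with refl ← x∈⁅y⁆⇒x≡y i j∈i = contradiction j∈ (i∉p-i (p ∪ ⁅ i ⁆))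
      bwd : ∀ {j} → j ∈ₛ p → j ∈ₛ (p ∪ ⁅ i ⁆) - i
      bwd j∈p = x∈p∧x≢y⇒x∈p-y (x∈p∪q⁺ (inj₁ j∈p)) λ { refl → i∉p j∈p }

    remove-add : ∀ {i} {p : Subset n} → i ∈ₛ p → (p - i) ∪ ⁅ i ⁆ ≡ p
    remove-add {i} {p} i∈p = ⊆-antisym fwd bwd
      where
      fwd : ∀ {j} → j ∈ₛ (p - i) ∪ ⁅ i ⁆ → j ∈ₛ p
      fwd j∈ with x∈p∪q⁻ (p - i) ⁅ i ⁆ j∈
      ... | inj₁ j∈p-i = p─q⊆p p ⁅ i ⁆ j∈p-i
      ... | inj₂ j∈i with refl ← x∈⁅y⁆⇒x≡y i j∈i = i∈p
      bwd : ∀ {j} → j ∈ₛ p → j ∈ₛ (p - i) ∪ ⁅ i ⁆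
      bwd {j} j∈p with j Fin.≟ i
      ... | yes refl = x∈p∪q⁺ (inj₂ (x∈⁅x⁆ i))
      ... | no  j≢i  = x∈p∪q⁺ (inj₁ (x∈p∧x≢y⇒x∈p-y j∈p j≢i))

module _ (P : FinitePoset) where
  open FinitePoset P

  -- Subsets of the poset are bit vectors indexed by its enumeration.
  IsIdeal : Pred (Subset size) 0ℓ
  IsIdeal S = ∀ x y → x ≤ y → index y ∈ₛ S → index x ∈ₛ S

  isIdeal? : Decidable IsIdeal
  isIdeal? S = ∀? λ x → ∀? λ y → (x ≤? y) →-dec ((index y ∈? S) →-dec (index x ∈? S))

  J : Set
  J = [ S ∈ Subset size ∣ IsIdeal S ]

  J-finite : Finite J
  J-finite = Refinement-finite isIdeal? (Subset-finite size)

  toggle : Carrier → J → J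
  toggle x I with index x ∈? value I
  toggle x I | no _ with isIdeal? (value I ∪ ⁅ index x ⁆)
  ... | yes ideal = (value I ∪ ⁅ index x ⁆) , [ ideal ]
  ... | no  _     = I
  toggle x I | yes _ with isIdeal? (value I - index x)
  ... | yes ideal = (value I - index x) , [ ideal ]
  ... | no  _     = I

  toggle-add : ∀ x (I : J) → index x ∉ₛ value I → IsIdeal (value I ∪ ⁅ index x ⁆) →
               value (toggle x I) ≡ value I ∪ ⁅ index x ⁆
  toggle-add x I x∉I ideal with index x ∈? value I
  ... | yes x∈I = contradiction x∈I x∉I
  ... | no  _ with isIdeal? (value I ∪ ⁅ index x ⁆)
  ...   | yes _      = refl
  ...   | no  ¬ideal = contradiction ideal ¬ideal

  toggle-remove : ∀ x (I : J) → index x ∈ₛ value I → IsIdeal (value I - index x) →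
                  value (toggle x I) ≡ value I - index x
  toggle-remove x I x∈I ideal with index x ∈? value I
  ... | no  x∉I = contradiction x∈I x∉I
  ... | yes _ with isIdeal? (value I - index x)
  ...   | yes _      = refl
  ...   | no  ¬ideal = contradiction ideal ¬ideal

  toggle-fix-∉ : ∀ x (I : J) → index x ∉ₛ value I → ¬ IsIdeal (value I ∪ ⁅ index x ⁆) →
                 toggle x I ≡ I
  toggle-fix-∉ x I x∉I ¬ideal with index x ∈? value I
  ... | yes x∈I = contradiction x∈I x∉I
  ... | no  _ with isIdeal? (value I ∪ ⁅ index x ⁆)
  ...   | yes ideal = contradiction ideal ¬ideal
  ...   | no  _     = refl

  toggle-fix-∈ : ∀ x (I : J) → index x ∈ₛ value I → ¬ IsIdeal (value I - index x) →
                 toggle x I ≡ I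
  toggle-fix-∈ x I x∈I ¬ideal with index x ∈? value I
  ... | no  x∉I = contradiction x∈I x∉I
  ... | yes _ with isIdeal? (value I - index x)
  ...   | yes ideal = contradiction ideal ¬ideal
  ...   | no  _     = refl

  toggle-involutive : ∀ x (I : J) → toggle x (toggle x I) ≡ I
  toggle-involutive x I = go (index x ∈? value I) (isIdeal? (value I ∪ ⁅ i ⁆)) (isIdeal? (value I - i))
    where
    i = index x
    I′ = toggle x I
    ideal : IsIdeal (value I)
    ideal = refinement-holds isIdeal? I

    go : Dec (i ∈ₛ value I) → Dec (IsIdeal (value I ∪ ⁅ i ⁆)) → Dec (IsIdeal (value I - i)) →
         toggle x I′ ≡ I
    go (no x∉I) (yes p) _ = value-injective
      (trans (toggle-remove x I′ (subst (i ∈ₛ_) (sym eq) (x∈p∪q⁺ (inj₂ (x∈⁅x⁆ i))))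
                                 (subst IsIdeal (sym back) ideal))
             back)
      where
      eq = toggle-add x I x∉I p
      back : value I′ - i ≡ value I
      back = trans (cong (_- i) eq) (add-remove x∉I)
    go (no x∉I) (no ¬p) _ = trans (cong (toggle x) eq) eq
      where eq = toggle-fix-∉ x I x∉I ¬p
    go (yes x∈I) _ (yes p) = value-injective
      (trans (toggle-add x I′ (subst (i ∉ₛ_) (sym eq) (i∉p-i (value I)))
                              (subst IsIdeal (sym back) ideal))
             back)
      where
      eq = toggle-remove x I x∈I p
      back : value I′ ∪ ⁅ i ⁆ ≡ value I
      back = trans (cong (_∪ ⁅ i ⁆) eq) (remove-add x∈I)
    go (yes x∈I) _ (no ¬p) = trans (cong (toggle x) eq) eq
      where eq = toggle-fix-∈ x I x∈I ¬p

  σ : Carrier → J ↔ J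
  σ x = mk↔ₛ′ (toggle x) (toggle x) (toggle-involutive x) (toggle-involutive x)

  record Chain : Set where
    field
      members    : List Carrier
      increasing : AllPairs _<_ members

  -- σ_{x₁} ∘ ⋯ ∘ σ_{xₘ} for x₁ < ⋯ < xₘ: the largest element is toggled first.
  σ-chain : Chain → J ↔ J
  σ-chain C = foldr (λ x g → σ x ↔-∘ g) (↔-id J) (Chain.members C)

------------------------------------------------------------------------
-- The poset 𝓛 a; the set [a] is represented by Fin a, i.e. k ∈ [a] by
-- the element of Fin a with value k - 1.

𝓛-Carrier : ℕ → Set
𝓛-Carrier a = [ p ∈ Fin a × Fin a ∣ proj₁ p Fin.≤ proj₂ p ]

i≤j? : ∀ {a} → Decidable (λ (p : Fin a × Fin a) → proj₁ p Fin.≤ proj₂ p)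
i≤j? (i , j) = i Fin.≤? j

_≤𝓛_ : ∀ {a} → Rel (𝓛-Carrier a) 0ℓ
x ≤𝓛 y = proj₁ (value x) Fin.≤ proj₁ (value y) × proj₂ (value x) Fin.≤ proj₂ (value y)

𝓛 : ℕ → FinitePoset
𝓛 a = record
  { Carrier           = 𝓛-Carrier a
  ; finite            = 𝓛-finite
  ; _≤_               = _≤𝓛_
  ; isDecPartialOrder = record
    { isPartialOrder = record
      { isPreorder = record
        { isEquivalence = isEquivalence
        ; reflexive     = λ { refl → ℕ.≤-refl , ℕ.≤-refl }
        ; trans         = λ (p , q) (p′ , q′) → ℕ.≤-trans p p′ , ℕ.≤-trans q q′
        }
      ; antisym = λ (p , q) (p′ , q′) →
          value-injective (cong₂ _,_ (Fin.≤-antisym p p′) (Fin.≤-antisym q q′))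
      }
    ; _≟_  = Finite._≟_ 𝓛-finite
    ; _≤?_ = λ x y → (proj₁ (value x) Fin.≤? proj₁ (value y)) ×-dec (proj₂ (value x) Fin.≤? proj₂ (value y))
    }
  }
  where
  𝓛-finite : Finite (𝓛-Carrier a)
  𝓛-finite = Refinement-finite i≤j? (×-finite (Fin-finite a) (Fin-finite a))

module _ {a : ℕ} where
  open FinitePoset (𝓛 a) using (index; _<_)

  column : Fin a → Chain (𝓛 a)
  column c = record
    { members    = refineAll i≤j? pairs
    ; increasing = AllPairs.map (λ {x} {y} → strict {x} {y}) (AllPairs.map⁻ {f = value}
        (subst (AllPairs _≺_) (sym (map-value-refineAll i≤j? pairs))
          (AllPairs.filter⁺ i≤j? (AllPairs.map⁺ (AllPairs.tabulate⁺-< λ j<k → refl , j<k)))))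
    }
    where
    pairs : List (Fin a × Fin a)
    pairs = map (c ,_) (allFin a)
    _≺_ : Rel (Fin a × Fin a) 0ℓ
    p ≺ q = proj₁ p ≡ proj₁ q × proj₂ p Fin.< proj₂ q
    strict : ∀ {x y : 𝓛-Carrier a} → value x ≺ value y → x < y
    strict (eq , j<k) =
      (ℕ.≤-reflexive (cong toℕ eq) , ℕ.<⇒≤ j<k) ,
      λ x≡y → Fin.<⇒≢ j<k (cong (proj₂ ∘ value) x≡y)

  columnSize : Fin a → J (𝓛 a) → ℕ
  columnSize c I = length (filter (λ x → index x ∈? value I) (Chain.members (column c)))

  comotion : Permutation′ a → J (𝓛 a) ↔ J (𝓛 a)
  comotion ν = foldl (λ g c → σ-chain (𝓛 a) (column c) ↔-∘ g) (↔-id (J (𝓛 a)))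
                     (map (ν ⟨$⟩ʳ_) (allFin a))

  s : Fin a → J (𝓛 a) → ℕ
  s j I = length (filter (λ i → columnSize i I ℕ.≟ suc (toℕ j)) (allFin a))

  linearCombination : (Fin a → ℝ) → J (𝓛 a) → ℝ
  linearCombination c I = sum (map (λ j → c j * fromℕ (s j I)) (allFin a))

{-# OPTIONS --safe #-}
-- An ideal is determined by its column sizes, which are a ≥ h₁ > h₂ > ⋯ followed
-- by zeros.  Toggling a column shifts its size cyclically within the interval
-- allowed by the two neighbouring columns; hence toggles of non-adjacent columns
-- commute, and every 𝒯_ν becomes the left-to-right sweep after commutations and
-- cyclic rotations of the word ν(1) ⋯ ν(a).  A rotation replaces W ∘ σ_C by the
-- conjugate σ_C ∘ W.  Because W does not touch C, corresponding orbits show the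
-- same sizes in every column, those of C one step later; so the orbit sums of the
-- s_j agree.  For the sweep, the set {h_i} ∖ {0} ⊆ [a] is shifted by one, and 1 is
-- inserted exactly if a was absent.  Hence s_{j+1} ∘ 𝒯 = s_j and s_1 ∘ 𝒯 + s_a = 1,
-- and so every s_j has average 1/2.
module Submission where

import Algebra.Properties.CommutativeSemigroup as CommutativeSemigroup
open import Data.Bool.Base using (true; false; if_then_else_)
open import Data.Fin.Base as Fin using (Fin; toℕ; fromℕ<)
open import Data.Fin.Permutation using (_⟨$⟩ʳ_; Permutation′; _⟨$⟩ˡ_; inverseʳ)
import Data.Fin.Properties as Fin
open import Data.Fin.Subset using (Subset; ⁅_⁆; _∪_; _-_) renaming (_∈_ to _∈ₛ_; _∉_ to _∉ₛ_)
open import Data.Fin.Subset.Properties using (_∈?_; x∈⁅x⁆; x∈⁅y⁆⇒x≡y; x∈p∪q⁻; x∈p∪q⁺; x∈p∧x≢y⇒x∈p-y; p─q⊆p; p─q─q≡p─q; x∈p⇒p-x⊂p; ⊆-antisym)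
import Data.Integer.Base as ℤ
import Data.Integer.Properties as ℤ
open import Data.Irrelevant using ([_])
open import Data.List.Base using (List; []; _∷_; _++_; _∷ʳ_; map; length; iterate; filter; tabulate; lookup; allFin; foldr; foldl)
import Data.List.Membership.DecPropositional as DecMembership
open import Data.List.Membership.Propositional using (_∈_; _∉_; lose; find)
open import Data.List.Membership.Propositional.Properties using (∈-∃++; ∈-deduplicate⁺; ∈-deduplicate⁻; ∈-map⁺; ∈-map⁻; ∈-allFin; ∈-filter⁺; ∈-lookup)
import Data.List.Membership.Setoid.Properties as SetoidMembership
open import Data.List.Properties using (++-identityʳ; map-++; map-∘; map-cong; map-id; length-map; filter-none; length-filter; filter-accept; filter-reject)
open import Data.List.Relation.Binary.Permutation.Propositional using (_↭_; ↭-sym; ↭-trans; ↭-reflexive; ↭-prep; ↭-refl)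
open import Data.List.Relation.Binary.Permutation.Propositional.Properties using (∈-resp-↭; All-resp-↭; drop-mid; ↭-empty-inv; shift; map⁺; ↭-length)
open import Data.List.Relation.Unary.All as All using (All; []; _∷_)
import Data.List.Relation.Unary.All.Properties as All
open import Data.List.Relation.Unary.AllPairs as AllPairs using (AllPairs; []; _∷_)
import Data.List.Relation.Unary.AllPairs.Properties as AllPairs
open import Data.List.Relation.Unary.Any as Any using (here; there; Any)
import Data.List.Relation.Unary.Any.Properties as Any
import Data.List.Relation.Unary.Unique.DecPropositional.Properties as DecUnique
import Data.List.Relation.Unary.Unique.DecSetoid.Properties as DecSetoidUnique
open import Data.List.Relation.Unary.Unique.Propositional using (Unique)
import Data.List.Relation.Unary.Unique.Propositional.Properties as Unique
open import Data.List.Reverse using (Reverse; reverseView; []; _∶_∶ʳ_)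
open import Data.Nat.Base as ℕ using (ℕ; zero; suc; _≤_; _<_; z≤n; s≤s)
open import Data.Nat.GeneralisedArithmetic using (fold; fold-+)
import Data.Nat.ListAction as ℕ
import Data.Nat.ListAction.Properties as ℕ
import Data.Nat.Properties as ℕ
open import Data.Product.Base using (∃-syntax; _×_; _,_; proj₁; proj₂)
open import Data.Rational.Base as ℚ using (ℚ; 0ℚ; 1ℚ; ½)
import Data.Rational.Properties as ℚ
open import Data.Rational.Solver using (module +-*-Solver)
import Data.Rational.Unnormalised.Base as ℚᵘ
import Data.Rational.Unnormalised.Properties as ℚᵘ
open import Data.Refinement.Base using (_,_; value)
open import Data.Refinement.Properties using (value-injective)
open import Data.Sum.Base as Sum using (_⊎_; inj₁; inj₂)
open import Function.Base using (id; _∘_)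
open import Function.Bundles using (_↔_; module Inverse; module Injection)
open import Function.Construct.Composition using (_↔-∘_)
open import Function.Construct.Identity using (↔-id)
open import Function.Properties.Inverse using (↔⇒↣)
open import Level using (0ℓ)
open import Relation.Binary.Bundles using (DecSetoid)
open import Relation.Binary.Construct.Closure.ReflexiveTransitive using (Star; ε; _◅_; _◅◅_; gmap)
open import Relation.Binary.Core using (Rel)
open import Relation.Binary.Definitions using (Symmetric; Transitive; tri<; tri≈; tri>)
open import Relation.Binary.PropositionalEquality using (_≡_; _≢_; refl; sym; trans; cong; cong₂; subst; subst₂; setoid; module ≡-Reasoning)
open import Relation.Nullary using (¬_; contradiction; Dec; yes; no)
open import Relation.Unary using (Pred; Decidable)
open import Defs

-- Sorting a word is the argument that all Coxeter elements of a path are conjugate. The largest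
-- letter x commutes with all smaller letters except at most one, so the other letters can be sorted
-- by induction while x is carried along, and x can afterwards be brought to an end of the word. The
-- bijection of a rotation does not preserve s_j, and no common time shift repairs this: column C is
-- shifted by one step, the other columns by none. Only orbit sums of functions of a single column
-- size survive, which is why s_j is split into one indicator per column. In the sweep each column
-- meets a left neighbour that has already moved. If the first column rises, it makes room for the
-- second, and so on up to the first empty column. If it is full, no column finds room, and the wrap
-- runs through all of them. The average 1/2 is carried along as "twice the orbit sum is the orbit
-- length", an equation in ℕ; rationals and reals enter only at the end.

-- Sorting words by commutations and rotations

module _ {a : ℕ} where

  Far : Fin a → Fin a → Set
  Far c d = suc (toℕ c) < toℕ d ⊎ suc (toℕ d) < toℕ c

  Far-sym : ∀ {c d} → Far c d → Far d c
  Far-sym (inj₁ p) = inj₂ p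
  Far-sym (inj₂ p) = inj₁ p

  data Swap : List (Fin a) → List (Fin a) → Set where
    here  : ∀ {c d w} → Far c d → Swap (c ∷ d ∷ w) (d ∷ c ∷ w)
    there : ∀ {c v w} → Swap v w → Swap (c ∷ v) (c ∷ w)

  -- The condition `c ∉ w` matters for the orbit sums: it keeps column `c` constant while the
  -- letters of `w` act.
  data Step : List (Fin a) → List (Fin a) → Set where
    swap   : ∀ {v w} → Swap v w → Step v w
    rotate : ∀ {c w} → c ∉ w → Step (c ∷ w) (w ∷ʳ c)

  data Insert (x : Fin a) : List (Fin a) → List (Fin a) → Set where
    here  : ∀ {w} → Insert x w (x ∷ w)
    there : ∀ {c v w} → Insert x v w → Insert x (c ∷ v) (c ∷ w)

  Insert-++ : ∀ {x} u {v} → Insert x (u ++ v) (u ++ x ∷ v)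
  Insert-++ []      = here
  Insert-++ (c ∷ u) = there (Insert-++ u)

  Insert-∷ʳ : ∀ {x v w} c → Insert x v w → Insert x (v ∷ʳ c) (w ∷ʳ c)
  Insert-∷ʳ c here      = here
  Insert-∷ʳ c (there i) = there (Insert-∷ʳ c i)

  Insert-∉ : ∀ {x c v w} → Insert x v w → c ≢ x → c ∉ v → c ∉ w
  Insert-∉ here      c≢x c∉v (here c≡x)  = c≢x c≡x
  Insert-∉ here      c≢x c∉v (there c∈)  = c∉v c∈
  Insert-∉ (there i) c≢x c∉v (here c≡d)  = c∉v (here c≡d)
  Insert-∉ (there i) c≢x c∉v (there c∈)  = Insert-∉ i c≢x (λ c∈v → c∉v (there c∈v)) c∈

  All<⇒∉ : ∀ {x} {w : List (Fin a)} → All (Fin._< x) w → x ∉ w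
  All<⇒∉ (c<x ∷ _)  (here refl) = ℕ.<-irrefl refl c<x
  All<⇒∉ (_ ∷ w<x) (there x∈)  = All<⇒∉ w<x x∈

  module _ {x : Fin a} where

    Swap-All : ∀ {v w} → Swap v w → All (Fin._< x) v → All (Fin._< x) w
    Swap-All (here _)  (c<x ∷ d<x ∷ ps) = d<x ∷ c<x ∷ ps
    Swap-All (there s) (c<x ∷ ps)       = c<x ∷ Swap-All s ps

    Step-All : ∀ {v w} → Step v w → All (Fin._< x) v → All (Fin._< x) w
    Step-All (swap s)   ps       = Swap-All s ps
    Step-All (rotate _) (p ∷ ps) = All.++⁺ ps (p ∷ [])

    -- A letter exceeding two far-apart letters is far from one of them, so it
    -- can be moved out of the way of their exchange.
    lift-swap : ∀ {v w v̂} → All (Fin._< x) v → Swap v w → Insert x v v̂ →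
                ∃[ ŵ ] (Insert x w ŵ × Star Swap v̂ ŵ)
    lift-swap _ s here = _ , here , there s ◅ ε
    lift-swap (_ ∷ d<x ∷ _) (here (inj₁ c≪d)) (there here) =
      _ , here ,
      here (inj₁ (ℕ.<-trans c≪d d<x)) ◅ there (here (inj₁ c≪d)) ◅ ε
    lift-swap (c<x ∷ _ ∷ _) (here (inj₂ d≪c)) (there here) =
      _ , there (there here) ,
      there (here (inj₂ (ℕ.<-trans d≪c c<x))) ◅ here (inj₂ d≪c) ◅ ε
    lift-swap _ (here far) (there (there i)) = _ , there (there i) , here far ◅ ε
    lift-swap (_ ∷ ps) (there s) (there i) with ŵ , j , ss ← lift-swap ps s i =
      _ , there j , gmap (_ ∷_) there ss

    lift-step : ∀ {v w v̂} → All (Fin._< x) v → Step v w → Insert x v v̂ →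
                ∃[ ŵ ] (Insert x w ŵ × Star Step v̂ ŵ)
    lift-step ps (swap s) i with ŵ , j , ss ← lift-swap ps s i = ŵ , j , gmap id swap ss
    -- Here `x` stands in front of the letter to be rotated, so `x` goes to the back first and `c`
    -- follows it.
    lift-step ps@(c<x ∷ _) (rotate {c} {w} c∉w) here =
      (w ∷ʳ x) ∷ʳ c , Insert-∷ʳ c (subst (λ v → Insert x v (w ∷ʳ x)) (++-identityʳ w) (Insert-++ w)) ,
      rotate (All<⇒∉ ps) ◅ rotate c∉ ◅ ε
      where
      c∉ : c ∉ w ∷ʳ x
      c∉ c∈ with Any.++⁻ w c∈
      ... | inj₁ c∈w         = c∉w c∈w
      ... | inj₂ (here refl) = ℕ.<-irrefl refl c<x
    lift-step (c<x ∷ _) (rotate {c} c∉w) (there i) =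
      _ , Insert-∷ʳ c i , rotate (Insert-∉ i (λ { refl → ℕ.<-irrefl refl c<x }) c∉w) ◅ ε

    lift-steps : ∀ {v w v̂} → All (Fin._< x) v → Star Step v w → Insert x v v̂ →
                 ∃[ ŵ ] (Insert x w ŵ × Star Step v̂ ŵ)
    lift-steps ps ε        i = _ , i , ε
    lift-steps ps (s ◅ ss) i with v₁ , i₁ , ss₁ ← lift-step ps s i
      with ŵ , j , ss₂ ← lift-steps (Step-All s ps) ss i₁ = ŵ , j , ss₁ ◅◅ ss₂

    -- The inserted letter moves freely except past the last letter of w.
    insert-front-or-back : ∀ {w ŵ} → AllPairs Fin._<_ w → All (Fin._< x) w → Insert x w ŵ →
                           (ŵ ≡ w ∷ʳ x) ⊎ Star Swap ŵ (x ∷ w)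
    insert-front-or-back _ _ here = inj₂ ε
    insert-front-or-back {c ∷ []} _ _ (there here) = inj₁ refl
    insert-front-or-back {c ∷ d ∷ w} ((c<d ∷ _) ∷ incr) (_ ∷ d<x ∷ ps) (there i)
      with insert-front-or-back incr (d<x ∷ ps) i
    ... | inj₁ refl = inj₁ refl
    ... | inj₂ ss   = inj₂ (gmap (c ∷_) there ss ◅◅ here (inj₁ (ℕ.≤-<-trans c<d d<x)) ◅ ε)

    insert-to-back : ∀ {w ŵ} → AllPairs Fin._<_ w → All (Fin._< x) w → Insert x w ŵ →
                     Star Step ŵ (w ∷ʳ x)
    insert-to-back incr ps i with insert-front-or-back incr ps i
    ... | inj₁ refl = ε
    ... | inj₂ ss   = gmap id swap ss ◅◅ rotate (All<⇒∉ ps) ◅ ε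

  AllPairs-∷ʳ⁻ : ∀ w {x : Fin a} → AllPairs Fin._<_ (w ∷ʳ x) → AllPairs Fin._<_ w × All (Fin._< x) w
  AllPairs-∷ʳ⁻ []      _           = [] , []
  AllPairs-∷ʳ⁻ (c ∷ w) (ps ∷ incr) with qs , w<x ← AllPairs-∷ʳ⁻ w incr | ps′ , (c<x ∷ []) ← All.++⁻ w ps =
    ps′ ∷ qs , c<x ∷ w<x

  -- Induction from the right end of the sorted word, hence the reverse view: remove the largest
  -- letter, sort the rest, lift these steps to the full word, and move the largest letter to the
  -- back.
  sort-by-steps : ∀ {v w} → AllPairs Fin._<_ w → v ↭ w → Star Step v w
  sort-by-steps {w = w} = go (reverseView w)
    where
    go : ∀ {v w} → Reverse w → AllPairs Fin._<_ w → v ↭ w → Star Step v w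
    go [] _ v↭ rewrite ↭-empty-inv v↭ = ε
    go (w ∶ rw ∶ʳ x) incr v↭ with ps , w<x ← AllPairs-∷ʳ⁻ w incr
      | u₁ , u₂ , refl ← ∈-∃++ (∈-resp-↭ (↭-sym v↭) (Any.++⁺ʳ w (here refl)))
      with u↭w ← ↭-trans (drop-mid u₁ w {u₂} {[]} v↭) (↭-reflexive (++-identityʳ w))
      with _ , i , ss ← lift-steps (All-resp-↭ (↭-sym u↭w) w<x) (go rw ps u↭w) (Insert-++ u₁)
      = ss ◅◅ insert-to-back ps w<x i

-- Orbits, transversals and conjugation

module _ {A B : Set} {_~_ : Rel A 0ℓ} (~-sym : Symmetric _~_) (~-trans : Transitive _~_)
         (f : A → B) (f-resp : ∀ {x y} → x ~ y → f x ≡ f y) where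

  private
    _≁_ : Rel A 0ℓ
    x ≁ y = ¬ (x ~ y)

  AllPairs-drop-mid : ∀ us {y vs} → AllPairs _≁_ (us ++ y ∷ vs) →
                      AllPairs _≁_ (us ++ vs) × All (y ≁_) (us ++ vs)
  AllPairs-drop-mid []       (ps ∷ pss) = pss , ps
  AllPairs-drop-mid (u ∷ us) (ps ∷ pss)
    with qss , qs ← AllPairs-drop-mid us pss | rs , (u≁y ∷ rs′) ← All.++⁻ us ps =
    All.++⁺ rs rs′ ∷ qss , (u≁y ∘ ~-sym) ∷ qs

  -- Both lists are transversals of the same classes. The head `x` has exactly one partner `y` in
  -- the other list; remove the pair and continue. With equality as the relation this compares
  -- duplicate-free lists, with orbit equivalence it compares lists of orbit sizes.
  transversals-↭ : ∀ {xs ys} → AllPairs _≁_ xs → AllPairs _≁_ ys →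
                   All (λ x → Any (x ~_) ys) xs → All (λ y → Any (y ~_) xs) ys →
                   map f xs ↭ map f ys
  transversals-↭ {[]} {[]}    _ _ _ _              = ↭-reflexive refl
  transversals-↭ {[]} {_ ∷ _} _ _ _ (() ∷ _)
  transversals-↭ {x ∷ xs} (ps ∷ pss) qss (x~ys ∷ xs~ys) ys~xs
    with y , y∈ , x~y ← find x~ys
    with us , vs , refl ← ∈-∃++ y∈
    with qss′ , qs ← AllPairs-drop-mid us qss =
    ↭-trans (↭-prep (f x) (transversals-↭ pss qss′ covers₁ covers₂))
    (↭-trans (↭-reflexive (cong₂ _∷_ (f-resp x~y) (map-++ f us vs)))
    (↭-trans (↭-sym (shift (f y) (map f us) (map f vs)))
             (↭-reflexive (sym (map-++ f us (y ∷ vs))))))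
    where
    covers₁ : All (λ z → Any (z ~_) (us ++ vs)) xs
    covers₁ = All.zipWith drop (ps , xs~ys)
      where
      drop : ∀ {z} → x ≁ z × Any (z ~_) (us ++ y ∷ vs) → Any (z ~_) (us ++ vs)
      drop (x≁z , z~) with Any.++⁻ us z~
      ... | inj₁ p         = Any.++⁺ˡ p
      ... | inj₂ (here p)  = contradiction (~-trans x~y (~-sym p)) x≁z
      ... | inj₂ (there p) = Any.++⁺ʳ us p
    covers₂ : All (λ z → Any (z ~_) xs) (us ++ vs)
    covers₂ = All.zipWith drop (qs , All.++⁺ (proj₁ split) (All.tail (proj₂ split)))
      where
      split = All.++⁻ us ys~xs
      drop : ∀ {z} → y ≁ z × Any (z ~_) (x ∷ xs) → Any (z ~_) xs
      drop (y≁z , here z~x) = contradiction (~-sym (~-trans z~x x~y)) y≁z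
      drop (_   , there p)  = p

unique-↭ : ∀ {A : Set} {xs ys : List A} → Unique xs → Unique ys →
           (∀ {x} → x ∈ xs → x ∈ ys) → (∀ {y} → y ∈ ys → y ∈ xs) → xs ↭ ys
unique-↭ {xs = xs} {ys} xs! ys! ⊆ ⊇ = subst₂ _↭_ (map-id xs) (map-id ys)
  (transversals-↭ sym trans id id xs! ys! (All.tabulate ⊆) (All.tabulate ⊇))

module _ {X : Set} (F : Finite X) where
  open Finite F

  index-injective : ∀ {x y} → index x ≡ index y → x ≡ y
  index-injective {x} {y} = SetoidMembership.index-injective (setoid X) (complete x) (complete y)

fold-shift : ∀ {X : Set} (f : X → X) x n → fold (f x) f n ≡ f (fold x f n)
fold-shift f x zero    = refl
fold-shift f x (suc n) = cong f (fold-shift f x n)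

∈-iterate⁺ : ∀ {X : Set} (f : X → X) x {n N} → n < N → fold x f n ∈ iterate f x N
∈-iterate⁺ f x {zero}  (s≤s _) = here refl
∈-iterate⁺ f x {suc n} (s≤s p) = there (subst (_∈ _) (fold-shift f x n) (∈-iterate⁺ f (f x) p))

∈-iterate⁻ : ∀ {X : Set} (f : X → X) x N {y} → y ∈ iterate f x N → ∃[ n ] (n < N × y ≡ fold x f n)
∈-iterate⁻ f x (suc N) (here refl) = 0 , s≤s z≤n , refl
∈-iterate⁻ f x (suc N) (there y∈) with n , n<N , eq ← ∈-iterate⁻ f (f x) N y∈ =
  suc n , s≤s n<N , trans eq (fold-shift f x n)

module Orbit {X : Set} (F : Finite X) (τ : X ↔ X) where
  open Finite F
  open DecMembership _≟_ using () renaming (_∈?_ to _∈ₗ?_)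

  T : X → X
  T = Inverse.to τ

  T-injective : ∀ {x y} → T x ≡ T y → x ≡ y
  T-injective = Injection.injective (↔⇒↣ τ)

  fold-injective : ∀ n {x y} → fold x T n ≡ fold y T n → x ≡ y
  fold-injective zero    eq = eq
  fold-injective (suc n) eq = fold-injective n (T-injective eq)

  -- Two of the iterates number 0 to `size` coincide, and injectivity cancels the common initial
  -- power of `T`. The bound on the period is what makes the truncation at `size` iterates in
  -- `orbit` harmless.
  period : ∀ x → ∃[ p ] (suc p ≤ size × fold x T (suc p) ≡ x)
  period x with i , j , i<j , eq ← Fin.pigeonhole (ℕ.n<1+n size) (λ k → index (fold x T (toℕ k)))
    with k , 1+i+k≡j ← ℕ.m≤n⇒∃[o]m+o≡n i<j =
    k , bound , fold-injective (toℕ i) (trans (sym (fold-+ _ _ (toℕ i))) (trans (cong (fold x T) i+1+k≡j) (sym (index-injective F eq))))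
    where
    i+1+k≡j : toℕ i ℕ.+ suc k ≡ toℕ j
    i+1+k≡j = trans (ℕ.+-suc (toℕ i) k) 1+i+k≡j
    bound : suc k ≤ size
    bound = ℕ.≤-trans (ℕ.m≤n+m (suc k) (toℕ i)) (ℕ.≤-trans (ℕ.≤-reflexive i+1+k≡j) (ℕ.s≤s⁻¹ (Fin.toℕ<n j)))

  ∈-orbit⁻ : ∀ {x y} → y ∈ orbit F τ x → ∃[ n ] (n < size × y ≡ fold x T n)
  ∈-orbit⁻ {x} y∈ = ∈-iterate⁻ T x size (∈-deduplicate⁻ _≟_ _ y∈)

  fold-∈-orbit-< : ∀ {x n} → n < size → fold x T n ∈ orbit F τ x
  fold-∈-orbit-< {x} n< = ∈-deduplicate⁺ _≟_ (∈-iterate⁺ T x n<)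

  orbit-closed : ∀ {x y} → y ∈ orbit F τ x → T y ∈ orbit F τ x
  orbit-closed {x} y∈ with n , n<N , refl ← ∈-orbit⁻ y∈ with ℕ.m≤n⇒m<n∨m≡n n<N
  ... | inj₁ 1+n<N = fold-∈-orbit-< 1+n<N
  -- The image of the last listed iterate has number `size`; dropping one period leads back to a
  -- listed one.
  ... | inj₂ 1+n≡N with p , p<N , eq ← period x =
    subst (_∈ orbit F τ x) wrap (fold-∈-orbit-< (ℕ.≤-trans (ℕ.≤-reflexive (sym (ℕ.+-∸-assoc 1 p<N))) (ℕ.m∸n≤m size p)))
    where
    open ≡-Reasoning
    wrap : fold x T (size ℕ.∸ suc p) ≡ fold x T (suc n)
    wrap = begin
      fold x T (size ℕ.∸ suc p)                    ≡⟨ cong (λ z → fold z T (size ℕ.∸ suc p)) eq ⟨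
      fold (fold x T (suc p)) T (size ℕ.∸ suc p)   ≡⟨ fold-+ _ _ (size ℕ.∸ suc p) ⟨
      fold x T (size ℕ.∸ suc p ℕ.+ suc p)          ≡⟨ cong (fold x T) (trans (ℕ.m∸n+n≡m p<N) (sym 1+n≡N)) ⟩
      fold x T (suc n)                             ∎

  fold-∈-orbit : ∀ x n → fold x T n ∈ orbit F τ x
  fold-∈-orbit x zero    with _ , p<N , _ ← period x = fold-∈-orbit-< (ℕ.≤-trans (s≤s z≤n) p<N)
  fold-∈-orbit x (suc n) = orbit-closed (fold-∈-orbit x n)

  orbit-refl : ∀ {x} → x ∈ orbit F τ x
  orbit-refl {x} = fold-∈-orbit x 0

  orbit-trans : ∀ {x y z} → y ∈ orbit F τ x → z ∈ orbit F τ y → z ∈ orbit F τ x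
  orbit-trans {x} y∈ z∈ with m , _ , refl ← ∈-orbit⁻ y∈ with n , _ , refl ← ∈-orbit⁻ z∈ =
    subst (_∈ orbit F τ x) (fold-+ _ _ n) (fold-∈-orbit x (n ℕ.+ m))

  -- From the `k`-th iterate, `k * p` further steps complete `k` full periods of length `suc p`.
  orbit-sym : ∀ {x y} → y ∈ orbit F τ x → x ∈ orbit F τ y
  orbit-sym {x} y∈ with k , _ , refl ← ∈-orbit⁻ y∈ with p , _ , eq ← period x =
    subst (_∈ orbit F τ (fold x T k)) back (fold-∈-orbit (fold x T k) (k ℕ.* p))
    where
    open ≡-Reasoning
    wind : ∀ m → fold x T (m ℕ.* suc p) ≡ x
    wind zero    = refl
    wind (suc m) = trans (fold-+ x T (suc p)) (trans (cong (λ z → fold z T (suc p)) (wind m)) eq)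
    back : fold (fold x T k) T (k ℕ.* p) ≡ x
    back = begin
      fold (fold x T k) T (k ℕ.* p)  ≡⟨ fold-+ _ _ (k ℕ.* p) ⟨
      fold x T (k ℕ.* p ℕ.+ k)       ≡⟨ cong (fold x T) (trans (ℕ.+-comm (k ℕ.* p) k) (sym (ℕ.*-suc k p))) ⟩
      fold x T (k ℕ.* suc p)         ≡⟨ wind k ⟩
      x                              ∎

  orbit-unique : ∀ x → Unique (orbit F τ x)
  orbit-unique x = DecUnique.deduplicate-! _≟_ (iterate T x size)

  orbit-cong : ∀ {x y} → y ∈ orbit F τ x → orbit F τ x ↭ orbit F τ y
  orbit-cong {x} {y} y∈ = unique-↭ (orbit-unique x) (orbit-unique y) (orbit-trans (orbit-sym y∈)) (orbit-trans y∈)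

  -- The decision procedure is literally the one by which `orbitRepresentatives` deduplicates, so
  -- the general facts on deduplication apply to that list.
  decSetoid : DecSetoid 0ℓ 0ℓ
  decSetoid = record
    { Carrier = X
    ; _≈_ = λ x y → y ∈ orbit F τ x
    ; isDecEquivalence = record
      { isEquivalence = record { refl = orbit-refl ; sym = orbit-sym ; trans = orbit-trans }
      ; _≟_ = λ x y → y ∈ₗ? orbit F τ x
      }
    }

  representatives-inequivalent : AllPairs (λ x y → ¬ (y ∈ orbit F τ x)) (orbitRepresentatives F τ)
  representatives-inequivalent = DecSetoidUnique.deduplicate-! decSetoid elements

  representatives-cover : ∀ x → Any (λ y → y ∈ orbit F τ x) (orbitRepresentatives F τ)
  representatives-cover x =
    Any.deduplicate⁺ (λ x y → y ∈ₗ? orbit F τ x) (λ z∈y y∈x → orbit-trans y∈x (orbit-sym z∈y))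
      (lose (complete x) orbit-refl)

module Conjugate {X : Set} (F : Finite X) {τ τ′ : X ↔ X} (φ : X ↔ X)
  (intertwines : ∀ x → Inverse.to φ (Inverse.to τ x) ≡ Inverse.to τ′ (Inverse.to φ x)) where

  private
    module O  = Orbit F τ
    module O′ = Orbit F τ′
    f = Inverse.to φ

  fold-intertwines : ∀ x n → f (fold x O.T n) ≡ fold (f x) O′.T n
  fold-intertwines x zero    = refl
  fold-intertwines x (suc n) = trans (intertwines _) (cong O′.T (fold-intertwines x n))

  ∈-orbit-map : ∀ {x y} → y ∈ orbit F τ x → f y ∈ orbit F τ′ (f x)
  ∈-orbit-map {x} y∈ with n , _ , refl ← O.∈-orbit⁻ y∈ =
    subst (_∈ _) (sym (fold-intertwines x n)) (O′.fold-∈-orbit (f x) n)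

  orbit-conjugate : ∀ x → map f (orbit F τ x) ↭ orbit F τ′ (f x)
  orbit-conjugate x = unique-↭
    (Unique.map⁺ (Injection.injective (↔⇒↣ φ)) (O.orbit-unique x)) (O′.orbit-unique (f x)) ⊆ ⊇
    where
    ⊆ : ∀ {y} → y ∈ map f (orbit F τ x) → y ∈ orbit F τ′ (f x)
    ⊆ y∈ with z , z∈ , refl ← ∈-map⁻ f y∈ = ∈-orbit-map z∈
    ⊇ : ∀ {y} → y ∈ orbit F τ′ (f x) → y ∈ map f (orbit F τ x)
    ⊇ y∈ with n , _ , refl ← O′.∈-orbit⁻ y∈ =
      subst (_∈ _) (fold-intertwines x n) (∈-map⁺ f (O.fold-∈-orbit x n))

  orbit-length : ∀ x → length (orbit F τ x) ≡ length (orbit F τ′ (f x))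
  orbit-length x = trans (sym (length-map f (orbit F τ x))) (↭-length (orbit-conjugate x))

  orbit-sum : ∀ (g : X → ℕ) x → ℕ.sum (map g (orbit F τ′ (f x))) ≡ ℕ.sum (map (g ∘ f) (orbit F τ x))
  orbit-sum g x = trans (sym (ℕ.sum-↭ (map⁺ g (orbit-conjugate x)))) (cong ℕ.sum (sym (map-∘ (orbit F τ x))))

  ∈-orbit-unmap : ∀ {x y} → f y ∈ orbit F τ′ (f x) → y ∈ orbit F τ x
  ∈-orbit-unmap {x} fy∈ with n , _ , eq ← O′.∈-orbit⁻ fy∈ =
    subst (_∈ _) (sym (Injection.injective (↔⇒↣ φ) (trans eq (sym (fold-intertwines x n))))) (O.fold-∈-orbit x n)

  -- The images of the representatives chosen for `τ` need not be those chosen for `τ′`, but they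
  -- also form a transversal of the orbits of `τ′`.
  orbitSizes-conjugate : orbitSizes F τ ↭ orbitSizes F τ′
  orbitSizes-conjugate = ↭-trans
    (↭-reflexive (trans (map-cong orbit-length reps) (map-∘ reps)))
    (transversals-↭ O′.orbit-sym O′.orbit-trans (length ∘ orbit F τ′) (↭-length ∘ O′.orbit-cong)
      (AllPairs.map⁺ (AllPairs.map (_∘ ∈-orbit-unmap) O.representatives-inequivalent))
      O′.representatives-inequivalent
      (All.universal O′.representatives-cover _)
      (All.universal covers _))
    where
    reps = orbitRepresentatives F τ
    covers : ∀ y → Any (λ x → x ∈ orbit F τ′ y) (map f reps)
    covers y = Any.map⁺ (Any.map (λ z∈ → subst (λ y → _ ∈ orbit F τ′ y) (Inverse.strictlyInverseˡ φ y) (∈-orbit-map z∈))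
                                 (O.representatives-cover (Inverse.from φ y)))

module _ {X : Set} (F : Finite X) (τ : X ↔ X) where

  -- `τ` conjugates itself to itself, and the orbit listed from `τ x` rearranges the one listed from
  -- `x`.
  orbit-sum-shift : ∀ (g : X → ℕ) x → ℕ.sum (map (g ∘ Inverse.to τ) (orbit F τ x)) ≡ ℕ.sum (map g (orbit F τ x))
  orbit-sum-shift g x = trans (sym (Conjugate.orbit-sum F {τ} {τ} τ (λ _ → refl) g x))
    (ℕ.sum-↭ (map⁺ g (↭-sym (O.orbit-cong (O.orbit-closed O.orbit-refl)))))
    where module O = Orbit F τ

-- Toggles described by membership

lookup-injective : ∀ {A : Set} {xs : List A} → Unique xs → ∀ i j → lookup xs i ≡ lookup xs j → i ≡ j
lookup-injective (_ ∷ _)   Fin.zero    Fin.zero    _  = refl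
lookup-injective (ps ∷ _)  Fin.zero    (Fin.suc j) eq = contradiction eq (All.lookup ps (∈-lookup j))
lookup-injective (ps ∷ _)  (Fin.suc i) Fin.zero    eq = contradiction (sym eq) (All.lookup ps (∈-lookup i))
lookup-injective (_ ∷ xs!) (Fin.suc i) (Fin.suc j) eq = cong Fin.suc (lookup-injective xs! i j eq)

module _ {X : Set} (F : Finite X) where
  open Finite F

  index-surjective : ∀ i → index (lookup elements i) ≡ i
  index-surjective i = lookup-injective unique _ _ (sym (Any.lookup-index (complete (lookup elements i))))

x∉p-x : ∀ {n i} (p : Subset n) → i ∉ₛ p - i
x∉p-x {i = i} p i∈ with _ , j , j∈ , j∉ ← x∈p⇒p-x⊂p {p = p - i} i∈ =
  j∉ (subst (j ∈ₛ_) (sym (p─q─q≡p─q p ⁅ i ⁆)) j∈)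

module Ideals (P : FinitePoset) where
  open FinitePoset P renaming (_≤_ to _≼_)

  -- Opaque because index and toggle unfold to very large terms.
  infix 4 _∈ᴶ_ _∉ᴶ_
  opaque
    _∈ᴶ_ : Carrier → J P → Set
    x ∈ᴶ I = index x ∈ₛ value I

    toggleᴶ : Carrier → J P → J P
    toggleᴶ = toggle P

  _∉ᴶ_ : Carrier → J P → Set
  x ∉ᴶ I = ¬ (x ∈ᴶ I)

  opaque
    unfolding _∈ᴶ_ toggleᴶ

    down-closed : ∀ {I x y} → x ≼ y → y ∈ᴶ I → x ∈ᴶ I
    down-closed {I} {x} {y} = refinement-holds (isIdeal? P) I x y

    J-ext : ∀ {I I′} → (∀ x → x ∈ᴶ I → x ∈ᴶ I′) → (∀ x → x ∈ᴶ I′ → x ∈ᴶ I) → I ≡ I′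
    J-ext {I} {I′} ⊆ ⊇ = value-injective (⊆-antisym (transport I I′ ⊆) (transport I′ I ⊇))
      where
      transport : ∀ I I′ → (∀ x → x ∈ᴶ I → x ∈ᴶ I′) → ∀ {i} → i ∈ₛ value I → i ∈ₛ value I′
      transport I I′ ⊆ {i} i∈ = subst (_∈ₛ value I′) (index-surjective finite i)
        (⊆ (lookup elements i) (subst (_∈ₛ value I) (sym (index-surjective finite i)) i∈))

  module _ (x : Carrier) (I : J P) where
    opaque
      unfolding _∈ᴶ_ toggleᴶ

      private
        ∪⁻ : ∀ {y} → y ≢ x → index y ∈ₛ value I ∪ ⁅ index x ⁆ → y ∈ᴶ I
        ∪⁻ y≢x y∈ with x∈p∪q⁻ (value I) ⁅ index x ⁆ y∈
        ... | inj₁ y∈I = y∈I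
        ... | inj₂ y∈x = contradiction (index-injective finite (x∈⁅y⁆⇒x≡y (index x) y∈x)) y≢x

        -⁺ : ∀ {y} → y ≢ x → y ∈ᴶ I → index y ∈ₛ value I - index x
        -⁺ y≢x y∈ = x∈p∧x≢y⇒x∈p-y y∈ (y≢x ∘ index-injective finite)

        addable : (∀ y → y ≼ x → y ≢ x → y ∈ᴶ I) → IsIdeal P (value I ∪ ⁅ index x ⁆)
        addable below y z y≼z z∈ with y ≟ x
        ... | yes refl = x∈p∪q⁺ (inj₂ (x∈⁅x⁆ (index x)))
        ... | no  y≢x with z ≟ x
        ...   | yes refl = x∈p∪q⁺ (inj₁ (below y y≼z y≢x))
        ...   | no  z≢x  = x∈p∪q⁺ (inj₁ (down-closed {I} y≼z (∪⁻ z≢x z∈)))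

        removable : (∀ y → x ≼ y → y ≢ x → y ∉ᴶ I) → IsIdeal P (value I - index x)
        removable above y z y≼z z∈ with y ≟ x | p─q⊆p (value I) ⁅ index x ⁆ z∈
        ... | no  y≢x  | z∈I = -⁺ y≢x (down-closed {I} y≼z z∈I)
        ... | yes refl | z∈I with z ≟ x
        ...   | yes refl = z∈
        ...   | no  z≢x  = contradiction z∈I (above z y≼z z≢x)

      toggle-adds : x ∉ᴶ I → (∀ y → y ≼ x → y ≢ x → y ∈ᴶ I) → x ∈ᴶ toggleᴶ x I
      toggle-adds x∉ below = subst (index x ∈ₛ_) (sym (toggle-add P x I x∉ (addable below))) (x∈p∪q⁺ (inj₂ (x∈⁅x⁆ (index x))))

      toggle-removes : x ∈ᴶ I → (∀ y → x ≼ y → y ≢ x → y ∉ᴶ I) → x ∉ᴶ toggleᴶ x I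
      toggle-removes x∈ above = subst (index x ∉ₛ_) (sym (toggle-remove P x I x∈ (removable above))) (x∉p-x (value I))

      -- A missing element below `x` excludes `x` from the ideal and also forbids adding it.
      toggle-blocked-below : ∀ {y} → y ≼ x → y ≢ x → y ∉ᴶ I → toggleᴶ x I ≡ I
      toggle-blocked-below y≼x y≢x y∉ = toggle-fix-∉ P x I (y∉ ∘ down-closed {I} y≼x)
        λ ideal → y∉ (∪⁻ y≢x (ideal _ _ y≼x (x∈p∪q⁺ (inj₂ (x∈⁅x⁆ (index x))))))

      toggle-blocked-above : ∀ {y} → x ≼ y → y ≢ x → y ∈ᴶ I → toggleᴶ x I ≡ I
      toggle-blocked-above x≼y y≢x y∈ = toggle-fix-∈ P x I (down-closed {I} x≼y y∈)
        λ ideal → x∉p-x (value I) (ideal _ _ x≼y (-⁺ y≢x y∈))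

      toggle-other : ∀ {y} → y ≢ x → (y ∈ᴶ I → y ∈ᴶ toggleᴶ x I) × (y ∈ᴶ toggleᴶ x I → y ∈ᴶ I)
      toggle-other {y} y≢x = go (index x ∈? value I) (isIdeal? P (value I ∪ ⁅ index x ⁆)) (isIdeal? P (value I - index x))
        where
        unchanged : toggleᴶ x I ≡ I → (y ∈ᴶ I → y ∈ᴶ toggleᴶ x I) × (y ∈ᴶ toggleᴶ x I → y ∈ᴶ I)
        unchanged eq = subst (y ∈ᴶ_) (sym eq) , subst (y ∈ᴶ_) eq
        go : Dec (x ∈ᴶ I) → Dec (IsIdeal P (value I ∪ ⁅ index x ⁆)) → Dec (IsIdeal P (value I - index x)) →
             (y ∈ᴶ I → y ∈ᴶ toggleᴶ x I) × (y ∈ᴶ toggleᴶ x I → y ∈ᴶ I)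
        go (no x∉)  (yes p) _ = subst (index y ∈ₛ_) (sym eq) ∘ x∈p∪q⁺ ∘ inj₁ , ∪⁻ y≢x ∘ subst (index y ∈ₛ_) eq
          where
          eq : value (toggle P x I) ≡ value I ∪ ⁅ index x ⁆
          eq = toggle-add P x I x∉ p
        go (no x∉)  (no ¬p) _ = unchanged (toggle-fix-∉ P x I x∉ ¬p)
        go (yes x∈) _ (yes p) = subst (index y ∈ₛ_) (sym eq) ∘ -⁺ y≢x , p─q⊆p (value I) ⁅ index x ⁆ ∘ subst (index y ∈ₛ_) eq
          where
          eq : value (toggle P x I) ≡ value I - index x
          eq = toggle-remove P x I x∈ p
        go (yes x∈) _ (no ¬p) = unchanged (toggle-fix-∈ P x I x∈ ¬p)

∈-refineAll : ∀ {A : Set} {P : Pred A 0ℓ} (P? : Decidable P) {xs} v → value v ∈ xs → v ∈ refineAll P? xs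
∈-refineAll P? {xs} v v∈
  with w , w∈ , eq ← ∈-map⁻ value (subst (value v ∈_) (sym (map-value-refineAll P? xs))
                                         (∈-filter⁺ P? v∈ (refinement-holds P? v)))
  = subst (_∈ refineAll P? xs) (sym (value-injective eq)) w∈

-- Column sizes of an ideal

-- Numbers list entries by `m`, ..., `n - 1` through a relation. It serves twice: for the elements
-- of a column with their heights, and for the letters of the sweep with their values.
data Consecutive {A : Set} (R : ℕ → A → Set) : ℕ → ℕ → List A → Set where
  []  : ∀ {m} → Consecutive R m m []
  _∷_ : ∀ {m n x xs} → R m x → Consecutive R (suc m) n xs → Consecutive R m n (x ∷ xs)

module _ {A : Set} {R : ℕ → A → Set} where

  Consecutive-start : ∀ {m m′ n xs} → m ≡ m′ → Consecutive R m n xs → Consecutive R m′ n xs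
  Consecutive-start refl rs = rs

  Consecutive-length : ∀ {m n xs} → Consecutive R m n xs → m ℕ.+ length xs ≡ n
  Consecutive-length {m} []       = ℕ.+-identityʳ m
  Consecutive-length {m} (_ ∷ rs) = trans (ℕ.+-suc m _) (Consecutive-length rs)

  Consecutive-∈ : ∀ {m n xs x} → Consecutive R m n xs → x ∈ xs → ∃[ k ] (m ≤ k × R k x)
  Consecutive-∈ (r ∷ _)  (here refl) = _ , ℕ.≤-refl , r
  Consecutive-∈ (_ ∷ rs) (there x∈) with k , m<k , r ← Consecutive-∈ rs x∈ = k , ℕ.<⇒≤ m<k , r

  module _ {P : Pred A 0ℓ} (P? : Decidable P) where

    -- A predicate inherited by earlier entries holds on an initial segment, so its length is a
    -- threshold for the numbers. This turns the count `columnSize` into a criterion for membership.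
    filter-initial : ∀ {m n xs} → Consecutive R m n xs → AllPairs (λ x y → P y → P x) xs →
      ∀ {x} → x ∈ xs → ∃[ k ] (R k x × (P x → k < m ℕ.+ length (filter P? xs)) × (k < m ℕ.+ length (filter P? xs) → P x))
    filter-initial {m} {xs = z ∷ zs} (r ∷ rs) (down ∷ downs) x∈ with P? z | x∈
    ... | yes pz | here refl = m , r , (λ _ → ℕ.m<m+n m (s≤s z≤n)) , λ _ → pz
    ... | yes pz | there x∈zs with k , r′ , to , from ← filter-initial rs downs x∈zs =
      k , r′ , (λ px → subst (k <_) (sym (ℕ.+-suc m _)) (to px)) , λ k< → from (subst (k <_) (ℕ.+-suc m _) k<)
    ... | no ¬pz | x∈zzs with k , m≤k , r′ ← Consecutive-∈ (r ∷ rs) x∈zzs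
      rewrite filter-none P? {zs} (All.map (λ d py → ¬pz (d py)) down) | ℕ.+-identityʳ m =
      k , r′ , (λ px → contradiction px (none x∈zzs)) , λ k<m → contradiction m≤k (ℕ.<⇒≱ k<m)
      where
      none : ∀ {x} → x ∈ z ∷ zs → ¬ P x
      none (here refl) = ¬pz
      none (there x∈)  = ¬pz ∘ All.lookup down x∈

module Columns (a : ℕ) where

  open FinitePoset (𝓛 a) using (Carrier; index) renaming (_≤_ to _≼_)
  open Ideals (𝓛 a)

  -- x lies in column i, with exactly k elements of that column below it.
  record At (i k : ℕ) (x : Carrier) : Set where
    constructor _,_
    field
      column≡ : toℕ (proj₁ (value x)) ≡ i
      row≡    : toℕ (proj₂ (value x)) ≡ i ℕ.+ k

  At-height-unique : ∀ {i k k′ x} → At i k x → At i k′ x → k ≡ k′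
  At-height-unique {i} (_ , p) (_ , q) = ℕ.+-cancelˡ-≡ i _ _ (trans (sym p) q)

  At-injective : ∀ {i k x y} → At i k x → At i k y → x ≡ y
  At-injective (p , q) (p′ , q′) = value-injective
    (cong₂ _,_ (Fin.toℕ-injective (trans p (sym p′))) (Fin.toℕ-injective (trans q (sym q′))))

  At-≢ : ∀ {i k i′ k′ x y} → i ≢ i′ ⊎ k ≢ k′ → At i k x → At i′ k′ y → x ≢ y
  At-≢ (inj₁ i≢i′) (p , _) (p′ , _) refl = i≢i′ (trans (sym p) p′)
  At-≢ (inj₂ k≢k′) (refl , q) (refl , q′) refl = k≢k′ (ℕ.+-cancelˡ-≡ _ _ _ (trans (sym q) q′))

  At-≼ : ∀ {i k i′ k′ x y} → At i k x → At i′ k′ y → i ≤ i′ → i ℕ.+ k ≤ i′ ℕ.+ k′ → x ≼ y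
  At-≼ (p , q) (p′ , q′) i≤ k≤ = subst₂ _≤_ (sym p) (sym p′) i≤ , subst₂ _≤_ (sym q) (sym q′) k≤

  At-≼⁻ : ∀ {i k i′ k′ x y} → At i k x → At i′ k′ y → x ≼ y → i ≤ i′ × i ℕ.+ k ≤ i′ ℕ.+ k′
  At-≼⁻ (p , q) (p′ , q′) (i≤ , k≤) = subst₂ _≤_ p p′ i≤ , subst₂ _≤_ q q′ k≤

  At-bound : ∀ {i k x} → At i k x → i ℕ.+ k < a
  At-bound {x = x} (_ , q) = subst (_< a) q (Fin.toℕ<n (proj₂ (value x)))

  At-column-bound : ∀ {i k x} → At i k x → i < a
  At-column-bound {x = x} (p , _) = subst (_< a) p (Fin.toℕ<n (proj₁ (value x)))

  at : ∀ i k → i ℕ.+ k < a → ∃[ x ] At i k x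
  at i k i+k<a = ((fromℕ< i<a , fromℕ< i+k<a) , [ ordered ]) , (Fin.toℕ-fromℕ< i<a , Fin.toℕ-fromℕ< i+k<a)
    where
    i<a = ℕ.≤-<-trans (ℕ.m≤m+n i k) i+k<a
    ordered : fromℕ< i<a Fin.≤ fromℕ< i+k<a
    ordered = subst₂ _≤_ (sym (Fin.toℕ-fromℕ< i<a)) (sym (Fin.toℕ-fromℕ< i+k<a)) (ℕ.m≤m+n i k)

  height : ∀ x → ∃[ k ] At (toℕ (proj₁ (value x))) k x
  height x = _ , (refl , sym (ℕ.m+[n∸m]≡n (refinement-holds i≤j? x)))

  -- The rows `b` below the diagonal are dropped by `refineAll`; truncated subtraction keeps
  -- `b ∸ toℕ c` at 0 meanwhile, so the numbering starts at the diagonal.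
  column-consecutive : ∀ c → Consecutive (At (toℕ c)) 0 (a ℕ.∸ toℕ c) (Chain.members (column c))
  column-consecutive c = Consecutive-start (ℕ.0∸n≡0 (toℕ c)) (go 0 id (λ _ → refl))
    where
    go : ∀ {n} b (f : Fin n → Fin a) → (∀ i → toℕ (f i) ≡ b ℕ.+ toℕ i) →
         Consecutive (At (toℕ c)) (b ℕ.∸ toℕ c) (b ℕ.+ n ℕ.∸ toℕ c) (refineAll i≤j? (map (c ,_) (tabulate f)))
    go {zero}  b f f≡ rewrite ℕ.+-identityʳ b = []
    go {suc n} b f f≡ with c Fin.≤? f Fin.zero | go (suc b) (f ∘ Fin.suc) (λ i → trans (f≡ (Fin.suc i)) (ℕ.+-suc b (toℕ i)))
    ... | yes c≤f | rest rewrite ℕ.+-suc b n =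
      (refl , trans f0≡b (sym (ℕ.m+[n∸m]≡n c≤b))) ∷ Consecutive-start (ℕ.+-∸-assoc 1 c≤b) rest
      where
      f0≡b = trans (f≡ Fin.zero) (ℕ.+-identityʳ b)
      c≤b = subst (toℕ c ≤_) f0≡b c≤f
    ... | no c≰f | rest rewrite ℕ.+-suc b n =
      Consecutive-start (trans (ℕ.m≤n⇒m∸n≡0 b<c) (sym (ℕ.m≤n⇒m∸n≡0 (ℕ.<⇒≤ b<c)))) rest
      where
      b<c = subst (_< toℕ c) (trans (f≡ Fin.zero) (ℕ.+-identityʳ b)) (ℕ.≰⇒> c≰f)

  ∈-column : ∀ c {k x} → At (toℕ c) k x → x ∈ Chain.members (column c)
  ∈-column c {x = x} (p , _) with refl ← Fin.toℕ-injective p =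
    ∈-refineAll i≤j? x (∈-map⁺ (c ,_) (∈-allFin (proj₂ (value x))))

  opaque
    unfolding _∈ᴶ_

    size : Fin a → J (𝓛 a) → ℕ
    size = columnSize

    size≡columnSize : ∀ c I → size c I ≡ columnSize c I
    size≡columnSize c I = refl

    size-bound : ∀ c I → toℕ c ℕ.+ size c I ≤ a
    size-bound c I = ℕ.≤-trans
      (ℕ.+-monoʳ-≤ (toℕ c) (ℕ.≤-trans (length-filter (λ x → index x ∈? value I) (Chain.members (column c)))
                                      (ℕ.≤-reflexive (Consecutive-length (column-consecutive c)))))
      (ℕ.≤-reflexive (ℕ.m+[n∸m]≡n (ℕ.<⇒≤ (Fin.toℕ<n c))))

    ∈-size : ∀ c I {k x} → At (toℕ c) k x → (x ∈ᴶ I → k < size c I) × (k < size c I → x ∈ᴶ I)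
    ∈-size c I {k} {x} at-x
      with k′ , at′ , to , from ← filter-initial (λ x → index x ∈? value I) (column-consecutive c)
             (AllPairs.map (λ x<y → down-closed {I} (proj₁ x<y)) (Chain.increasing (column c))) (∈-column c at-x)
      with refl ← At-height-unique {x = x} at′ at-x = to , from

  -- The column sizes, shifted by one and extended by a virtual full column of
  -- size a + 1 on the left and by empty columns on the right.
  H : J (𝓛 a) → ℕ → ℕ
  H I zero    = suc a
  H I (suc i) with i ℕ.<? a
  ... | yes i<a = size (fromℕ< i<a) I
  ... | no  _   = 0

  H-column : ∀ I c → H I (suc (toℕ c)) ≡ size c I
  H-column I c with toℕ c ℕ.<? a
  ... | yes c<a = cong (λ d → size d I) (Fin.fromℕ<-toℕ c c<a)
  ... | no  c≮a = contradiction (Fin.toℕ<n c) c≮a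

  H-beyond : ∀ I {i} → a ≤ i → H I (suc i) ≡ 0
  H-beyond I {i} a≤i with i ℕ.<? a
  ... | yes i<a = contradiction a≤i (ℕ.<⇒≱ i<a)
  ... | no  _   = refl

  module _ (I : J (𝓛 a)) {i k : ℕ} {x : Carrier} (at-x : At i k x) where

    private
      c = proj₁ (value x)
      H≡ : H I (suc i) ≡ size c I
      H≡ = trans (cong (H I ∘ suc) (sym (At.column≡ at-x))) (H-column I c)
      at-c : At (toℕ c) k x
      at-c = refl , trans (At.row≡ at-x) (cong (ℕ._+ k) (sym (At.column≡ at-x)))

    ∈⇒<H : x ∈ᴶ I → k < H I (suc i)
    ∈⇒<H x∈ = subst (k <_) (sym H≡) (proj₁ (∈-size c I at-c) x∈)

    <H⇒∈ : k < H I (suc i) → x ∈ᴶ I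
    <H⇒∈ k< = proj₂ (∈-size c I at-c) (subst (k <_) H≡ k<)

  H-bound : ∀ I {i} → i ≤ a → i ℕ.+ H I (suc i) ≤ a
  H-bound I {i} i≤a with i ℕ.<? a
  ... | yes i<a = subst (λ j → j ℕ.+ size (fromℕ< i<a) I ≤ a) (Fin.toℕ-fromℕ< i<a) (size-bound (fromℕ< i<a) I)
  ... | no  _   = subst (_≤ a) (sym (ℕ.+-identityʳ i)) i≤a

  -- If the two numbers differed, the element of the column at the smaller height would be both in
  -- and out of the ideal. It exists by `i + n ≤ a` in one case and by `H-bound` in the other.
  H-unique : ∀ I {i n} → i < a → i ℕ.+ n ≤ a →
             (∀ {k x} → At i k x → x ∈ᴶ I → k < n) → (∀ {k x} → At i k x → k < n → x ∈ᴶ I) →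
             H I (suc i) ≡ n
  H-unique I {i} {n} i<a i+n≤a to from with ℕ.<-cmp (H I (suc i)) n
  ... | tri≈ _ eq _ = eq
  ... | tri< H<n _ _ with x , at-x ← at i (H I (suc i)) (ℕ.<-≤-trans (ℕ.+-monoʳ-< i H<n) i+n≤a) =
    contradiction (∈⇒<H I at-x (from at-x H<n)) (ℕ.<-irrefl refl)
  ... | tri> _ _ n<H with x , at-x ← at i n (ℕ.<-≤-trans (ℕ.+-monoʳ-< i n<H) (H-bound I (ℕ.<⇒≤ i<a))) =
    contradiction (to at-x (<H⇒∈ I at-x n<H)) (ℕ.<-irrefl refl)

  H-injective : ∀ {I I′} → (∀ i → H I i ≡ H I′ i) → I ≡ I′
  H-injective {I} {I′} eq = J-ext (⊆ eq) (⊆ (sym ∘ eq))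
    where
    ⊆ : ∀ {I I′} → (∀ i → H I i ≡ H I′ i) → ∀ x → x ∈ᴶ I → x ∈ᴶ I′
    ⊆ {I} {I′} eq x x∈ with k , at-x ← height x =
      <H⇒∈ I′ at-x (subst (k <_) (eq _) (∈⇒<H I at-x x∈))

  -- One column to the left in the same row the height is larger by one, and down-closure puts that
  -- element into the ideal too. Empty columns may repeat, hence the alternative.
  H-strict : ∀ I i → H I (suc i) < H I i ⊎ H I (suc i) ≡ 0
  H-strict I i with H I (suc i) in eq
  ... | zero  = inj₂ refl
  ... | suc m = inj₁ (go i eq)
    where
    go : ∀ i → H I (suc i) ≡ suc m → suc m < H I i
    go i eq with ℕ.≤-<-connex a i
    go i eq | inj₁ a≤i = contradiction (trans (sym eq) (H-beyond I a≤i)) λ ()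
    go zero eq | inj₂ i<a = s≤s (subst (_≤ a) eq (H-bound I z≤n))
    go (suc i) eq | inj₂ i<a
      with x , at-x ← at (suc i) m (subst (_≤ a) (trans (cong (suc i ℕ.+_) eq) (ℕ.+-suc (suc i) m)) (H-bound I (ℕ.<⇒≤ i<a)))
      with y , at-y ← at i (suc m) (subst (_< a) (sym (ℕ.+-suc i m)) (At-bound at-x)) =
      ∈⇒<H I at-y (down-closed {I} (At-≼ at-y at-x (ℕ.n≤1+n i) (ℕ.≤-reflexive (ℕ.+-suc i m)))
                    (<H⇒∈ I at-x (subst (m <_) (sym eq) (ℕ.n<1+n m))))

-- A column toggle as a cyclic shift of one size

-- The least size allowed for a column whose right neighbour has size d.
least : ℕ → ℕ
least zero    = zero
least (suc d) = suc (suc d)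

-- The action of σ_C on the size h of a column whose left and right
-- neighbours have sizes u and d: the cyclic shift of the interval of sizes
-- allowed by the neighbours.
whirl : ℕ → ℕ → ℕ → ℕ
whirl u d h with suc h ℕ.<? u
... | yes _ = suc h
... | no  _ = least d

whirl-up : ∀ {u} d {h} → suc h < u → whirl u d h ≡ suc h
whirl-up {u} d {h} p with suc h ℕ.<? u
... | yes _ = refl
... | no ¬p = contradiction p ¬p

whirl-wrap : ∀ {u} d {h} → ¬ (suc h < u) → whirl u d h ≡ least d
whirl-wrap {u} d {h} ¬p with suc h ℕ.<? u
... | yes p = contradiction p ¬p
... | no _  = refl

module Toggling (a : ℕ) where
  open Columns a
  open FinitePoset (𝓛 a) using (Carrier; index) renaming (_≤_ to _≼_)
  open Ideals (𝓛 a)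

  record Resized (i v : ℕ) (I I′ : J (𝓛 a)) : Set where
    field
      new  : H I′ (suc i) ≡ v
      rest : ∀ {j} → j ≢ suc i → H I′ j ≡ H I j

  open Resized

  resized-refl : ∀ {i v I} → H I (suc i) ≡ v → Resized i v I I
  resized-refl eq = record { new = eq ; rest = λ _ → refl }

  resized-trans : ∀ {i v w I I′ I″} → Resized i v I I′ → Resized i w I′ I″ → Resized i w I I″
  resized-trans r r′ = record { new = new r′ ; rest = λ j≢ → trans (rest r′ j≢) (rest r j≢) }

  module _ (I : J (𝓛 a)) {i k : ℕ} {x : Carrier} (at-x : At i k x) where

    toggle-rest : ∀ {j} → j ≢ suc i → H (toggleᴶ x I) j ≡ H I j
    toggle-rest {zero}  _   = refl
    toggle-rest {suc j} j≢i with ℕ.≤-<-connex a j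
    ... | inj₁ a≤j = trans (H-beyond (toggleᴶ x I) a≤j) (sym (H-beyond I a≤j))
    ... | inj₂ j<a = H-unique (toggleᴶ x I) j<a (H-bound I (ℕ.<⇒≤ j<a))
      (λ at-y → ∈⇒<H I at-y ∘ proj₂ (toggle-other x I (distinct at-y)))
      (λ at-y → proj₁ (toggle-other x I (distinct at-y)) ∘ <H⇒∈ I at-y)
      where
      distinct : ∀ {k′ y} → At j k′ y → y ≢ x
      distinct at-y = At-≢ (inj₁ (j≢i ∘ cong suc)) at-y at-x

    -- Every element strictly below `x` lies in the column of `x` or below the left neighbour of `x`
    -- in its row. That neighbour has height `suc k`, so the hypothesis on `H I i` says that it is
    -- present.
    toggle-up : H I (suc i) ≡ k → suc k < H I i → Resized i (suc k) I (toggleᴶ x I)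
    toggle-up H≡k 1+k<u = record { new = H≡ ; rest = toggle-rest }
      where
      x∉ : x ∉ᴶ I
      x∉ x∈ = ℕ.<-irrefl (sym H≡k) (∈⇒<H I at-x x∈)
      left : ∀ {i i′ k′ y} → At i k x → suc k < H I i → At i′ k′ y → i′ < i → i′ ℕ.+ k′ ≤ i ℕ.+ k → y ∈ᴶ I
      left {suc m} at-x 1+k<u at-y (s≤s i′≤m) j′≤j
        with z , at-z ← at m (suc k) (subst (_< a) (sym (ℕ.+-suc m k)) (At-bound at-x)) =
        down-closed {I} (At-≼ at-y at-z i′≤m (ℕ.≤-trans j′≤j (ℕ.≤-reflexive (sym (ℕ.+-suc m k)))))
                        (<H⇒∈ I at-z 1+k<u)
      below : ∀ {i′ k′ y} → At i′ k′ y → y ≼ x → y ≢ x → y ∈ᴶ I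
      below {k′ = k′} at-y y≼x y≢x with i′≤i , j′≤j ← At-≼⁻ at-y at-x y≼x with ℕ.m≤n⇒m<n∨m≡n i′≤i
      ... | inj₁ i′<i = left at-x 1+k<u at-y i′<i j′≤j
      ... | inj₂ refl = <H⇒∈ I at-y (subst (k′ <_) (sym H≡k)
              (ℕ.≤∧≢⇒< (ℕ.+-cancelˡ-≤ i k′ k j′≤j) λ { refl → y≢x (At-injective at-y at-x) }))
      x∈′ : x ∈ᴶ toggleᴶ x I
      x∈′ = toggle-adds x I x∉ λ y → below (proj₂ (height y))
      H≡ : H (toggleᴶ x I) (suc i) ≡ suc k
      H≡ = H-unique (toggleᴶ x I) (At-column-bound at-x) (subst (_≤ a) (sym (ℕ.+-suc i k)) (At-bound at-x)) to from
        where
        to : ∀ {k′ y} → At i k′ y → y ∈ᴶ toggleᴶ x I → k′ < suc k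
        to {k′} {y} at-y y∈ with k′ ℕ.≟ k
        ... | yes refl = ℕ.≤-refl
        ... | no k′≢k  = ℕ.m<n⇒m<1+n (subst (k′ <_) H≡k
                (∈⇒<H I at-y (proj₂ (toggle-other x I (At-≢ (inj₂ k′≢k) at-y at-x)) y∈)))
        from : ∀ {k′ y} → At i k′ y → k′ < suc k → y ∈ᴶ toggleᴶ x I
        from {k′} {y} at-y (s≤s k′≤k) with k′ ℕ.≟ k
        ... | yes refl = subst (_∈ᴶ toggleᴶ x I) (At-injective at-x at-y) x∈′
        ... | no k′≢k  = proj₁ (toggle-other x I (At-≢ (inj₂ k′≢k) at-y at-x))
                (<H⇒∈ I at-y (subst (k′ <_) (sym H≡k) (ℕ.≤∧≢⇒< k′≤k k′≢k)))

    toggle-down : H I (suc i) ≡ suc k → H I (suc (suc i)) < k ⊎ H I (suc (suc i)) ≡ 0 →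
                  Resized i k I (toggleᴶ x I)
    toggle-down H≡1+k room = record { new = H≡ ; rest = toggle-rest }
      where
      x∈ : x ∈ᴶ I
      x∈ = <H⇒∈ I at-x (ℕ.≤-reflexive (sym H≡1+k))
      -- The height `m` of an absent element of the next column that bounds the given one from
      -- below: the diagonal element if that column is known to be empty, else the right neighbour
      -- of `x` in its row, at height `k - 1`.
      obstacle : ∀ {i′ k′} → H I (suc (suc i)) < k ⊎ H I (suc (suc i)) ≡ 0 → i < i′ → i ℕ.+ k ≤ i′ ℕ.+ k′ →
                 ∃[ m ] (suc i ℕ.+ m ≤ i′ ℕ.+ k′ × H I (suc (suc i)) ≤ m)
      obstacle {i′} {k′} (inj₂ d≡0) i<i′ j≤j′ = 0 , subst (_≤ i′ ℕ.+ k′) (sym (ℕ.+-identityʳ (suc i))) (ℕ.≤-trans i<i′ (ℕ.m≤m+n i′ k′)) ,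
                       ℕ.≤-reflexive d≡0
      obstacle {i′} {k′} (inj₁ d<k) i<i′ j≤j′ with m , refl ← ℕ.m≤n⇒∃[o]m+o≡n (ℕ.≤-trans (s≤s z≤n) d<k) =
            m , subst (_≤ i′ ℕ.+ k′) (ℕ.+-suc i m) j≤j′ , ℕ.s≤s⁻¹ d<k
      above : ∀ {i′ k′ y} → At i′ k′ y → x ≼ y → y ≢ x → y ∉ᴶ I
      above {i′} {k′} at-y x≼y y≢x y∈ with i≤i′ , j≤j′ ← At-≼⁻ at-x at-y x≼y with ℕ.m≤n⇒m<n∨m≡n i≤i′
      ... | inj₂ refl = y≢x (At-injective at-y (subst (λ k → At i k x)
              (ℕ.≤-antisym (ℕ.+-cancelˡ-≤ i k k′ j≤j′) (ℕ.s≤s⁻¹ (subst (k′ <_) H≡1+k (∈⇒<H I at-y y∈)))) at-x))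
      ... | inj₁ i<i′ with m , j″≤j′ , d≤m ← obstacle room i<i′ j≤j′
          with z , at-z ← at (suc i) m (ℕ.≤-<-trans j″≤j′ (At-bound at-y)) =
        ℕ.<⇒≱ (∈⇒<H I at-z (down-closed {I} (At-≼ at-z at-y i<i′ j″≤j′) y∈)) d≤m
      x∉′ : x ∉ᴶ toggleᴶ x I
      x∉′ = toggle-removes x I x∈ λ y → above (proj₂ (height y))
      H≡ : H (toggleᴶ x I) (suc i) ≡ k
      H≡ = H-unique (toggleᴶ x I) (At-column-bound at-x) (ℕ.<⇒≤ (At-bound at-x)) to from
        where
        to : ∀ {k′ y} → At i k′ y → y ∈ᴶ toggleᴶ x I → k′ < k
        to {k′} {y} at-y y∈ with k′ ℕ.≟ k
        ... | yes refl = contradiction (subst (_∈ᴶ toggleᴶ x I) (At-injective at-y at-x) y∈) x∉′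
        ... | no k′≢k  = ℕ.≤∧≢⇒< (ℕ.s≤s⁻¹ (subst (k′ <_) H≡1+k
                (∈⇒<H I at-y (proj₂ (toggle-other x I (At-≢ (inj₂ k′≢k) at-y at-x)) y∈)))) k′≢k
        from : ∀ {k′ y} → At i k′ y → k′ < k → y ∈ᴶ toggleᴶ x I
        from {k′} {y} at-y k′<k = proj₁ (toggle-other x I (At-≢ (inj₂ (ℕ.<⇒≢ k′<k)) at-y at-x))
                (<H⇒∈ I at-y (subst (k′ <_) (sym H≡1+k) (ℕ.m<n⇒m<1+n k′<k)))

    toggle-far-above : H I (suc i) < k → toggleᴶ x I ≡ I
    toggle-far-above h<k
      with z , at-z ← at i (H I (suc i)) (ℕ.<-trans (ℕ.+-monoʳ-< i h<k) (At-bound at-x)) =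
      toggle-blocked-below x I (At-≼ at-z at-x ℕ.≤-refl (ℕ.+-monoʳ-≤ i (ℕ.<⇒≤ h<k)))
        (At-≢ (inj₂ (ℕ.<⇒≢ h<k)) at-z at-x) (ℕ.<-irrefl refl ∘ ∈⇒<H I at-z)

    toggle-far-below : suc k < H I (suc i) → toggleᴶ x I ≡ I
    toggle-far-below 1+k<h
      with z , at-z ← at i (suc k) (ℕ.<-≤-trans (ℕ.+-monoʳ-< i 1+k<h) (H-bound I (ℕ.<⇒≤ (At-column-bound at-x)))) =
      toggle-blocked-above x I (At-≼ at-x at-z ℕ.≤-refl (ℕ.+-monoʳ-≤ i (ℕ.n≤1+n k)))
        (At-≢ (inj₂ ℕ.1+n≢n) at-z at-x) (<H⇒∈ I at-z 1+k<h)

  toggle-no-room-above : ∀ I {i k x} → At i k x → ¬ (suc k < H I i) → toggleᴶ x I ≡ I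
  -- The virtual column of size `a + 1` never obstructs the first column.
  toggle-no-room-above I {zero}  at-x ¬up = contradiction (s≤s (At-bound at-x)) ¬up
  toggle-no-room-above I {suc i} {k} {x} at-x ¬up
    with z , at-z ← at i (suc k) (subst (_< a) (sym (ℕ.+-suc i k)) (At-bound at-x)) =
    toggle-blocked-below x I (At-≼ at-z at-x (ℕ.n≤1+n i) (ℕ.≤-reflexive (ℕ.+-suc i k)))
      (At-≢ (inj₁ (ℕ.1+n≢n ∘ sym)) at-z at-x) (¬up ∘ ∈⇒<H I at-z)

  toggle-no-room-below : ∀ I {i k x} → At i (suc k) x → H I (suc (suc i)) ≡ suc k → toggleᴶ x I ≡ I
  toggle-no-room-below I {i} {k} {x} at-x d≡
    with z , at-z ← at (suc i) k (subst (_< a) (ℕ.+-suc i k) (At-bound at-x)) =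
    toggle-blocked-above x I (At-≼ at-x at-z (ℕ.n≤1+n i) (ℕ.≤-reflexive (ℕ.+-suc i k)))
      (At-≢ (inj₁ ℕ.1+n≢n) at-z at-x) (<H⇒∈ I at-z (ℕ.≤-reflexive (sym d≡)))

  σs : List Carrier → J (𝓛 a) → J (𝓛 a)
  σs []       I = I
  σs (x ∷ xs) I = toggleᴶ x (σs xs I)

  module _ (I : J (𝓛 a)) {i : ℕ} where

    private
      u = H I i
      h = H I (suc i)
      d = H I (suc (suc i))

    -- Above height `h` the element just on top of the column is missing and blocks the toggle; at
    -- height `h` itself the lack of room on the left blocks it.
    σs-idle : ∀ {m n xs} → Consecutive (At i) m n xs → h < m ⊎ (h ≤ m × ¬ (suc h < u)) → σs xs I ≡ I
    σs-idle [] _ = refl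
    σs-idle {m} (_∷_ {x = x} at-x rs) bound =
      trans (cong (toggleᴶ x) (σs-idle rs (inj₁ (s≤s h≤m)))) (fixed (ℕ.m≤n⇒m<n∨m≡n h≤m) bound)
      where
      h≤m = Sum.[ ℕ.<⇒≤ , proj₁ ] bound
      fixed : h < m ⊎ h ≡ m → h < m ⊎ (h ≤ m × ¬ (suc h < u)) → toggleᴶ x I ≡ I
      fixed (inj₁ h<m)  _                 = toggle-far-above I at-x h<m
      fixed (inj₂ _)    (inj₁ h<m)        = toggle-far-above I at-x h<m
      fixed (inj₂ refl) (inj₂ (_ , ¬up))  = toggle-no-room-above I at-x ¬up

    -- The toggles run from the top down: nothing happens above height `h`, the element at `h` is
    -- added, and from then on each lower element is blocked by the one on top of it.
    σs-up : ∀ {m n xs} → Consecutive (At i) m n xs → suc h < u → m ≤ h → h < n → Resized i (suc h) I (σs xs I)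
    σs-up [] _ m≤h h<n = contradiction m≤h (ℕ.<⇒≱ h<n)
    σs-up (_∷_ {x = x} {xs} at-x rs) up m≤h h<n with ℕ.m≤n⇒m<n∨m≡n m≤h
    ... | inj₂ refl = subst (λ I′ → Resized i (suc h) I (toggleᴶ x I′)) (sym (σs-idle rs (inj₁ ℕ.≤-refl)))
                        (toggle-up I at-x refl up)
    ... | inj₁ m<h with r ← σs-up rs up m<h h<n =
          subst (Resized i (suc h) I) (sym (toggle-far-below (σs xs I) at-x (subst (_ <_) (sym (new r)) (s≤s m<h)))) r

    least-≤ : least d ≤ h
    least-≤ with d | H-strict I (suc i)
    ... | zero  | _        = z≤n
    ... | suc _ | inj₁ d<h = d<h

    -- The invariant `m ⊔ least d` is the size once all heights from `m` upwards have been toggled: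
    -- elements are removed one by one until the right neighbour forbids it.
    σs-down : ∀ {m n xs} → Consecutive (At i) m n xs → ¬ (suc h < u) → m < h → h ≤ n →
              Resized i (m ℕ.⊔ least d) I (σs xs I)
    σs-down [] _ m<h h≤n = contradiction h≤n (ℕ.<⇒≱ m<h)
    σs-down {m} (_∷_ {x = x} {xs} at-x rs) ¬up m<h h≤n = toggled d refl
      where
      I₁ = σs xs I
      previous : Resized i (suc m ℕ.⊔ least d) I I₁
      previous with ℕ.m≤n⇒m<n∨m≡n m<h
      ... | inj₁ 1+m<h = σs-down rs ¬up 1+m<h h≤n
      ... | inj₂ 1+m≡h = subst (Resized i (suc m ℕ.⊔ least d) I) (sym (σs-idle rs (inj₂ (ℕ.≤-reflexive (sym 1+m≡h) , ¬up))))
              (resized-refl (sym (trans (ℕ.m≥n⇒m⊔n≡m (subst (least d ≤_) (sym 1+m≡h) least-≤)) 1+m≡h)))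
      d₁≡d : H I₁ (suc (suc i)) ≡ d
      d₁≡d = rest previous (ℕ.1+n≢n)
      removed : least d ≤ m → d < m ⊎ d ≡ 0 → Resized i (m ℕ.⊔ least d) I (toggleᴶ x I₁)
      removed l≤m room = subst (λ v → Resized i v I (toggleᴶ x I₁)) (sym (ℕ.m≥n⇒m⊔n≡m l≤m)) (resized-trans previous (toggle-down I₁ at-x
        (trans (new previous) (ℕ.m≥n⇒m⊔n≡m (ℕ.m≤n⇒m≤1+n l≤m)))
        (subst (λ d → d < m ⊎ d ≡ 0) (sym d₁≡d) room)))
      kept : m < least d → toggleᴶ x I₁ ≡ I₁ → Resized i (m ℕ.⊔ least d) I (toggleᴶ x I₁)
      kept m<l eq = subst₂ (λ v → Resized i v I) (trans (ℕ.m≤n⇒m⊔n≡n m<l) (sym (ℕ.m≤n⇒m⊔n≡n (ℕ.<⇒≤ m<l)))) (sym eq) previous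
      toggled : ∀ e → d ≡ e → Resized i (m ℕ.⊔ least d) I (toggleᴶ x I₁)
      toggled zero    d≡ = removed (subst (_≤ m) (cong least (sym d≡)) z≤n) (inj₂ d≡)
      toggled (suc e) d≡ with ℕ.<-cmp (suc e) m
      ... | tri< e<m _ _  = removed (subst (_≤ m) (cong least (sym d≡)) e<m) (inj₁ (subst (_< m) (sym d≡) e<m))
      ... | tri≈ _ refl _ = kept (subst (suc e <_) (cong least (sym d≡)) ℕ.≤-refl)
                                 (toggle-no-room-below I₁ at-x (trans d₁≡d d≡))
      ... | tri> _ _ m<e  = kept m<l (toggle-far-below I₁ at-x (subst (suc m <_)
              (sym (trans (new previous) (trans (ℕ.m≤n⇒m⊔n≡n m<l) (cong least d≡)))) (s≤s m<e)))
        where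
        m<l : m < least d
        m<l = subst (m <_) (cong least (sym d≡)) (ℕ.m<n⇒m<1+n m<e)

  up-bound : ∀ I {i} → i < a → suc (H I (suc i)) < H I i → H I (suc i) < a ℕ.∸ i
  up-bound I {zero}  _   (s≤s h<a) = h<a
  up-bound I {suc i} i<a up = ℕ.m+n≤o⇒m≤o∸n _ (begin
    suc (H I (suc (suc i))) ℕ.+ suc i  ≡⟨ ℕ.+-comm (suc (H I (suc (suc i)))) (suc i) ⟩
    suc i ℕ.+ suc (H I (suc (suc i)))  ≡⟨ ℕ.+-suc i _ ⟨
    i ℕ.+ suc (suc (H I (suc (suc i)))) ≤⟨ ℕ.+-monoʳ-≤ i up ⟩
    i ℕ.+ H I (suc i)                  ≤⟨ H-bound I (ℕ.<⇒≤ (ℕ.<-trans (ℕ.n<1+n i) i<a)) ⟩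
    a                                  ∎)
    where open ℕ.≤-Reasoning

  opaque
    unfolding toggleᴶ

    toggleColumn : Fin a → J (𝓛 a) → J (𝓛 a)
    toggleColumn c = Inverse.to (σ-chain (𝓛 a) (column c))

    toggleColumn≡to : ∀ c I → toggleColumn c I ≡ Inverse.to (σ-chain (𝓛 a) (column c)) I
    toggleColumn≡to c I = refl

    toggleColumn≡σs : ∀ c I → toggleColumn c I ≡ σs (Chain.members (column c)) I
    toggleColumn≡σs c I = go (Chain.members (column c))
      where
      go : ∀ xs → Inverse.to (foldr (λ x g → σ (𝓛 a) x ↔-∘ g) (↔-id (J (𝓛 a))) xs) I ≡ σs xs I
      go []       = refl
      go (x ∷ xs) = cong (toggle (𝓛 a) x) (go xs)

  toggleColumn-whirl : ∀ c I → let i = toℕ c in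
    Resized i (whirl (H I i) (H I (suc (suc i))) (H I (suc i))) I (toggleColumn c I)
  toggleColumn-whirl c I = subst (Resized i (whirl u d h) I) (sym (toggleColumn≡σs c I)) (go (suc h ℕ.<? u))
    where
    i = toℕ c
    i<a = Fin.toℕ<n c
    u = H I i
    h = H I (suc i)
    d = H I (suc (suc i))
    resized : ℕ → Set
    resized v = Resized i v I (σs (Chain.members (column c)) I)
    h≤n : h ≤ a ℕ.∸ i
    h≤n = ℕ.m+n≤o⇒m≤o∸n _ (subst (_≤ a) (ℕ.+-comm i _) (H-bound I (ℕ.<⇒≤ i<a)))
    go : Dec (suc h < u) → resized (whirl u d h)
    go (yes up) = subst resized (sym (whirl-up d up)) (σs-up I (column-consecutive c) up z≤n (up-bound I i<a up))
    go (no ¬up) = subst resized (sym (whirl-wrap d ¬up)) (wrap (ℕ.≤-<-connex h 0))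
      where
      wrap : h ≤ 0 ⊎ 0 < h → resized (least d)
      wrap (inj₂ 0<h) = σs-down I (column-consecutive c) ¬up 0<h h≤n
      -- An empty column without room stays empty, and `least d ≤ h` shows that `least d` is 0 as
      -- well.
      wrap (inj₁ h≤0) = subst (Resized i (least d) I) (sym (σs-idle I (column-consecutive c) (inj₂ (h≤0 , ¬up))))
        (resized-refl (trans (ℕ.n≤0⇒n≡0 h≤0) (sym (ℕ.n≤0⇒n≡0 (ℕ.≤-trans (least-≤ I) h≤0)))))

-- Counting in lists

sum-map-+ : ∀ {A : Set} (f g : A → ℕ) xs →
            ℕ.sum (map (λ x → f x ℕ.+ g x) xs) ≡ ℕ.sum (map f xs) ℕ.+ ℕ.sum (map g xs)
sum-map-+ f g []       = refl
sum-map-+ f g (x ∷ xs) = trans (cong (f x ℕ.+ g x ℕ.+_) (sum-map-+ f g xs))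
  (interchange (f x) (g x) (ℕ.sum (map f xs)) (ℕ.sum (map g xs)))
  where open CommutativeSemigroup ℕ.+-commutativeSemigroup using (interchange)

sum-map-1 : ∀ {A : Set} (xs : List A) → ℕ.sum (map (λ _ → 1) xs) ≡ length xs
sum-map-1 []       = refl
sum-map-1 (x ∷ xs) = cong suc (sum-map-1 xs)

filter-singleton : ∀ {A : Set} {P : Pred A 0ℓ} (P? : Decidable P) {x xs} → Unique xs → x ∈ xs →
                   P x → (∀ {y} → P y → y ≡ x) → length (filter P? xs) ≡ 1
filter-singleton P? (ps ∷ _) (here refl) px only =
  trans (cong length (filter-accept P? px))
        (cong (suc ∘ length) (filter-none P? (All.map (λ x≢y py → x≢y (sym (only py))) ps)))
filter-singleton P? (ps ∷ xs!) (there x∈) px only =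
  trans (cong length (filter-reject P? (λ py → All.lookup ps x∈ (only py))))
        (filter-singleton P? xs! x∈ px only)

-- Written with `≡ᵇ` because `ℕ._≟_` computes through it; `length-filter-≟` then needs only one
-- Boolean case split.
indicator : ℕ → ℕ → ℕ
indicator v n = if n ℕ.≡ᵇ v then 1 else 0

length-filter-≟ : ∀ {A : Set} (f : A → ℕ) v x xs →
  length (filter (λ y → f y ℕ.≟ v) (x ∷ xs)) ≡ indicator v (f x) ℕ.+ length (filter (λ y → f y ℕ.≟ v) xs)
length-filter-≟ f v x xs with f x ℕ.≡ᵇ v
... | true  = refl
... | false = refl

least-suc⁻ : ∀ {d v} → least d ≡ suc v → d ≡ v
least-suc⁻ {suc d} refl = refl

least-suc⁺ : ∀ {d} → d ≢ 0 → least d ≡ suc d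
least-suc⁺ {zero}  d≢0 = contradiction refl d≢0
least-suc⁺ {suc d} _   = refl

-- Hence a sweep that wraps leaves no column of size 1.
least≢1 : ∀ d → least d ≢ 1
least≢1 zero    ()
least≢1 (suc d) ()

least-bound : ∀ d → least d ≤ suc d
least-bound zero    = z≤n
least-bound (suc d) = ℕ.≤-refl

-- Words in the column toggles and the left-to-right sweep

module Words (a : ℕ) where
  open Columns a
  open Toggling a

  Ideal : Set
  Ideal = J (𝓛 a)

  H-toggle : ∀ c I → let i = toℕ c in
    H (toggleColumn c I) (suc i) ≡ whirl (H I i) (H I (suc (suc i))) (H I (suc i))
  H-toggle c I = Resized.new (toggleColumn-whirl c I)

  H-toggle-rest : ∀ c I {j} → j ≢ suc (toℕ c) → H (toggleColumn c I) j ≡ H I j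
  H-toggle-rest c I = Resized.rest (toggleColumn-whirl c I)

  toggleColumn-comm : ∀ {c d} → Far c d → ∀ I →
                      toggleColumn d (toggleColumn c I) ≡ toggleColumn c (toggleColumn d I)
  toggleColumn-comm {c} {d} far I = H-injective agree
    where
    same : ∀ {c d} → Far c d → H (toggleColumn d (toggleColumn c I)) (suc (toℕ c)) ≡ H (toggleColumn c (toggleColumn d I)) (suc (toℕ c))
    same {c} {d} far = begin
      H (toggleColumn d (toggleColumn c I)) (suc i)
        ≡⟨ H-toggle-rest d (toggleColumn c I) (apart far) ⟩
      H (toggleColumn c I) (suc i)
        ≡⟨ H-toggle c I ⟩
      whirl (H I i) (H I (suc (suc i))) (H I (suc i))
        ≡⟨ cong (λ u → whirl u _ _) (H-toggle-rest d I (apart-left far)) ⟨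
      whirl (H I′ i) (H I (suc (suc i))) (H I (suc i))
        ≡⟨ cong₂ (whirl (H I′ i)) (H-toggle-rest d I (apart-right far)) (H-toggle-rest d I (apart far)) ⟨
      whirl (H I′ i) (H I′ (suc (suc i))) (H I′ (suc i))
        ≡⟨ H-toggle c I′ ⟨
      H (toggleColumn c I′) (suc i) ∎
      where
      open ≡-Reasoning
      i = toℕ c
      I′ = toggleColumn d I
      apart : Far c d → suc (toℕ c) ≢ suc (toℕ d)
      apart (inj₁ p) eq = ℕ.<-irrefl (ℕ.suc-injective eq) (ℕ.<-trans (ℕ.n<1+n _) p)
      apart (inj₂ p) eq = ℕ.<-irrefl (ℕ.suc-injective (sym eq)) (ℕ.<-trans (ℕ.n<1+n _) p)
      apart-left : Far c d → toℕ c ≢ suc (toℕ d)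
      apart-left (inj₁ p) eq = ℕ.<-asym p (subst (toℕ d <_) (cong suc (sym eq)) (ℕ.m<n⇒m<1+n (ℕ.n<1+n (toℕ d))))
      apart-left (inj₂ p) eq = ℕ.<-irrefl (sym eq) p
      apart-right : Far c d → suc (suc (toℕ c)) ≢ suc (toℕ d)
      apart-right (inj₁ p) eq = ℕ.<-irrefl (ℕ.suc-injective eq) p
      apart-right (inj₂ p) eq = ℕ.<-asym p (ℕ.<-trans (ℕ.n<1+n (toℕ c)) (subst (suc (toℕ c) <_) eq (ℕ.n<1+n _)))
    agree : ∀ j → H (toggleColumn d (toggleColumn c I)) j ≡ H (toggleColumn c (toggleColumn d I)) j
    agree j with j ℕ.≟ suc (toℕ c) | j ℕ.≟ suc (toℕ d)
    ... | yes refl | _        = same far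
    ... | no _     | yes refl = sym (same (Far-sym far))
    ... | no j≢c   | no j≢d   = trans (trans (H-toggle-rest d (toggleColumn c I) j≢d) (H-toggle-rest c I j≢c))
                                 (sym (trans (H-toggle-rest c (toggleColumn d I) j≢c) (H-toggle-rest d I j≢d)))

  act : List (Fin a) → Ideal → Ideal
  act []      I = I
  act (c ∷ w) I = act w (toggleColumn c I)

  opaque
    word : List (Fin a) → Ideal ↔ Ideal
    word = foldl (λ g c → σ-chain (𝓛 a) (column c) ↔-∘ g) (↔-id Ideal)

    comotion≡word : ∀ ν → comotion ν ≡ word (map (ν ⟨$⟩ʳ_) (allFin a))
    comotion≡word ν = refl

    word-act : ∀ w I → Inverse.to (word w) I ≡ act w I
    word-act w I = go w (↔-id Ideal)
      where
      go : ∀ w g → Inverse.to (foldl (λ g c → σ-chain (𝓛 a) (column c) ↔-∘ g) g w) I ≡ act w (Inverse.to g I)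
      go []      g = refl
      go (c ∷ w) g = trans (go w (σ-chain (𝓛 a) (column c) ↔-∘ g)) (cong (act w) (sym (toggleColumn≡to c (Inverse.to g I))))

  act-∷ʳ : ∀ w {c} I → act (w ∷ʳ c) I ≡ toggleColumn c (act w I)
  act-∷ʳ []      I = refl
  act-∷ʳ (d ∷ w) I = act-∷ʳ w (toggleColumn d I)

  act-swap : ∀ {v w} → Swap v w → ∀ I → act v I ≡ act w I
  act-swap (here {w = w} far) I = cong (act w) (toggleColumn-comm far I)
  act-swap (there {c} s)      I = act-swap s (toggleColumn c I)

  act-rest : ∀ {c} w I → c ∉ w → H (act w I) (suc (toℕ c)) ≡ H I (suc (toℕ c))
  act-rest []      I _  = refl
  act-rest (d ∷ w) I c∉ = trans (act-rest w (toggleColumn d I) (c∉ ∘ there))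
    (H-toggle-rest d I (λ eq → c∉ (here (Fin.toℕ-injective (ℕ.suc-injective eq)))))

  Letters : ℕ → ℕ → List (Fin a) → Set
  Letters = Consecutive (λ k c → toℕ c ≡ k)

  allFin-letters : Letters 0 a (allFin a)
  allFin-letters = go id (λ _ → refl)
    where
    go : ∀ {n b} (f : Fin n → Fin a) → (∀ i → toℕ (f i) ≡ b ℕ.+ toℕ i) → Letters b (b ℕ.+ n) (tabulate f)
    go {zero}  {b} f f≡ = subst (λ e → Letters b e []) (sym (ℕ.+-identityʳ b)) []
    go {suc n} {b} f f≡ = trans (f≡ Fin.zero) (ℕ.+-identityʳ b) ∷
      subst (λ e → Letters (suc b) e (tabulate (f ∘ Fin.suc))) (sym (ℕ.+-suc b n))
        (go (f ∘ Fin.suc) (λ i → trans (f≡ (Fin.suc i)) (ℕ.+-suc b (toℕ i))))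

  sweep-fixes : ∀ {m n w} → Letters m n w → ∀ I {j} → j ≤ m → H (act w I) j ≡ H I j
  sweep-fixes []              I j≤m = refl
  sweep-fixes (_∷_ {x = c} refl ls) I j≤m =
    trans (sweep-fixes ls (toggleColumn c I) (ℕ.m≤n⇒m≤1+n j≤m)) (H-toggle-rest c I (ℕ.<⇒≢ (s≤s j≤m)))

  -- When the turn of a column comes, its left neighbour already has its final size, while the
  -- column itself and its right neighbour still have their old sizes.
  sweep-whirl : ∀ {m n w} → Letters m n w → ∀ I {i} → m ≤ i → i < n →
    H (act w I) (suc i) ≡ whirl (H (act w I) i) (H I (suc (suc i))) (H I (suc i))
  sweep-whirl [] I m≤i i<m = contradiction m≤i (ℕ.<⇒≱ i<m)
  sweep-whirl (_∷_ {xs = w} refl ls) I {i} m≤i i<n with ℕ.m≤n⇒m<n∨m≡n m≤i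
  sweep-whirl (_∷_ {x = c} {xs = w} refl ls) I {i} m≤i i<n | inj₁ m<i = trans
    (sweep-whirl ls (toggleColumn c I) m<i i<n)
    (cong₂ (whirl (H (act w (toggleColumn c I)) i))
      (H-toggle-rest c I (λ eq → ℕ.<-irrefl (sym (ℕ.suc-injective eq)) (ℕ.m<n⇒m<1+n m<i)))
      (H-toggle-rest c I (λ eq → ℕ.<-irrefl (sym (ℕ.suc-injective eq)) m<i)))
  sweep-whirl (_∷_ {x = c} {xs = w} refl ls) I m≤i i<n | inj₂ refl = begin
    H (act w I₁) (suc i)
      ≡⟨ sweep-fixes ls I₁ ℕ.≤-refl ⟩
    H I₁ (suc i)
      ≡⟨ H-toggle c I ⟩
    whirl (H I i) (H I (suc (suc i))) (H I (suc i))
      ≡⟨ cong (λ u → whirl u (H I (suc (suc i))) (H I (suc i)))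
           (trans (sweep-fixes ls I₁ (ℕ.n≤1+n i)) (H-toggle-rest c I (ℕ.<⇒≢ (ℕ.n<1+n i)))) ⟨
    whirl (H (act w I₁) i) (H I (suc (suc i))) (H I (suc i)) ∎
    where
    open ≡-Reasoning
    i = toℕ c
    I₁ = toggleColumn c I

  module Sweep (I : Ideal) where

    sweep : Ideal
    sweep = act (allFin a) I

    recurrence : ∀ {i} → i < a → H sweep (suc i) ≡ whirl (H sweep i) (H I (suc (suc i))) (H I (suc i))
    recurrence = sweep-whirl allFin-letters I z≤n

    H-zero : ∀ {i} → H I i ≡ 0 → H I (suc i) ≡ 0
    H-zero {i} eq with H-strict I i
    ... | inj₁ h<  = contradiction (subst (H I (suc i) <_) eq h<) λ ()
    ... | inj₂ h≡0 = h≡0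

    -- A left neighbour that has just risen makes room: `h < u` becomes `suc h < suc u`. The first
    -- empty column thus rises to 1; behind it the left neighbour has size at most 1, so nothing
    -- changes.
    sweep-up : H I 1 < a → ∀ {i} → i < a →
               (H I i ≢ 0 → H sweep (suc i) ≡ suc (H I (suc i))) × (H I i ≡ 0 → H sweep (suc i) ≡ 0)
    sweep-up h<a {zero}  i<a = (λ _ → trans (recurrence i<a) (whirl-up (H I 2) (s≤s h<a))) , λ ()
    sweep-up h<a {suc i} i<a with up , zero′ ← sweep-up h<a {i} (ℕ.<-trans (ℕ.n<1+n i) i<a) = rises , stay
      where
      rises : H I (suc i) ≢ 0 → H sweep (suc (suc i)) ≡ suc (H I (suc (suc i)))
      rises h≢0 = trans (recurrence i<a) (whirl-up (H I (suc (suc (suc i))))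
        (subst (suc (H I (suc (suc i))) <_) (sym (up (h≢0 ∘ H-zero))) (s≤s below)))
        where
        below : H I (suc (suc i)) < H I (suc i)
        below with H-strict I (suc i)
        ... | inj₁ h<  = h<
        ... | inj₂ h≡0 = subst (_< H I (suc i)) (sym h≡0) (ℕ.n≢0⇒n>0 h≢0)
      stay : H I (suc i) ≡ 0 → H sweep (suc (suc i)) ≡ 0
      stay h≡0 = trans (recurrence i<a) (trans (whirl-wrap (H I (suc (suc (suc i)))) ¬up)
        (cong least (H-zero (H-zero h≡0))))
        where
        small : H sweep (suc i) ≤ 1
        small with H I i ℕ.≟ 0
        ... | yes eq = subst (_≤ 1) (sym (zero′ eq)) z≤n
        ... | no neq = ℕ.≤-reflexive (trans (up neq) (cong suc h≡0))
        ¬up : ¬ (suc (H I (suc (suc i))) < H sweep (suc i))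
        ¬up p = contradiction (ℕ.≤-trans (ℕ.≤-trans (s≤s (s≤s z≤n)) p) small) λ { (s≤s ()) }

    -- The left neighbour has become `least h`, where `h` is the old size of the column itself. As
    -- `least h ≤ suc h`, there is no room, and the wrap passes on to the next column.
    sweep-wrap : 1 ≤ a → H I 1 ≡ a → ∀ {i} → i ≤ a → H sweep i ≡ least (H I (suc i))
    -- The virtual column fits the formula, because `least a` is `suc a` for positive `a`.
    sweep-wrap 1≤a h≡a {zero}  _   = sym (trans (cong least h≡a) (least-suc⁺ (ℕ.m<n⇒n≢0 1≤a)))
    sweep-wrap 1≤a h≡a {suc i} i<a = trans (recurrence i<a) (whirl-wrap (H I (suc (suc i)))
      (λ p → ℕ.<⇒≱ p (ℕ.≤-trans (ℕ.≤-reflexive (sweep-wrap 1≤a h≡a (ℕ.<⇒≤ i<a))) (least-bound (H I (suc i))))))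

  module _ (I : Ideal) where

    H-antitone : ∀ {i} j → i < j → H I j ≡ 0 ⊎ H I j < H I i
    H-antitone (suc j) (s≤s i≤j) with H-strict I j | ℕ.m≤n⇒m<n∨m≡n i≤j
    ... | inj₂ h≡0 | _         = inj₁ h≡0
    ... | inj₁ h<  | inj₂ refl = inj₂ h<
    ... | inj₁ h<  | inj₁ i<j  with H-antitone j i<j
    ...   | inj₁ h′≡0 = contradiction (subst (H I (suc j) <_) h′≡0 h<) λ ()
    ...   | inj₂ h′<  = inj₂ (ℕ.<-trans h< h′<)

    -- A positive size occurs at most once, so `s j` takes only the values 0 and 1.
    H-nonzero-injective : ∀ {i j v} → H I i ≡ suc v → H I j ≡ suc v → i ≡ j
    H-nonzero-injective {i} {j} p q with ℕ.<-cmp i j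
    ... | tri≈ _ i≡j _ = i≡j
    ... | tri< i<j _ _ = contradiction (H-antitone j i<j)
          Sum.[ (λ h≡0 → contradiction (trans (sym q) h≡0) λ ()) , ℕ.<-irrefl (trans q (sym p)) ]
    ... | tri> _ _ j<i = contradiction (H-antitone i j<i)
          Sum.[ (λ h≡0 → contradiction (trans (sym p) h≡0) λ ()) , ℕ.<-irrefl (trans p (sym q)) ]

    columnSize≡H : ∀ c → columnSize c I ≡ H I (suc (toℕ c))
    columnSize≡H c = sym (trans (H-column I c) (size≡columnSize c I))

    s-present : ∀ {j i} → i < a → H I (suc i) ≡ suc (toℕ j) → s j I ≡ 1
    s-present {j} {i} i<a eq = filter-singleton (λ c → columnSize c I ℕ.≟ suc (toℕ j)) (Unique.allFin⁺ a)
      (∈-allFin (fromℕ< i<a)) (trans (columnSize≡H _) eq′)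
      (λ {d} p → Fin.toℕ-injective (ℕ.suc-injective (H-nonzero-injective (trans (sym (columnSize≡H d)) p) eq′)))
      where
      eq′ : H I (suc (toℕ (fromℕ< i<a))) ≡ suc (toℕ j)
      eq′ = trans (cong (H I ∘ suc) (Fin.toℕ-fromℕ< i<a)) eq

    s-absent : ∀ {j} → (∀ {i} → i < a → H I (suc i) ≢ suc (toℕ j)) → s j I ≡ 0
    s-absent {j} none = cong length (filter-none (λ c → columnSize c I ℕ.≟ suc (toℕ j))
      (All.universal (λ c p → none (Fin.toℕ<n c) (trans (sym (columnSize≡H c)) p)) (allFin a)))

    find-size : ∀ v → (∃[ i ] (i < a × H I (suc i) ≡ v)) ⊎ (∀ {i} → i < a → H I (suc i) ≢ v)
    find-size v with Fin.any? (λ c → H I (suc (toℕ c)) ℕ.≟ v)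
    ... | yes (c , eq) = inj₁ (toℕ c , Fin.toℕ<n c , eq)
    ... | no none      = inj₂ λ i<a eq → none (fromℕ< i<a , trans (cong (H I ∘ suc) (Fin.toℕ-fromℕ< i<a)) eq)

    -- The downward search must stop, since `H I 0` is `suc a`. The column found is the one that a
    -- rising sweep lifts to 1.
    first-zero : ∀ n → H I n ≡ 0 → ∃[ i ] (i < n × H I i ≢ 0 × H I (suc i) ≡ 0)
    first-zero (suc n) eq with H I n ℕ.≟ 0
    ... | no h≢0  = n , ℕ.n<1+n n , h≢0 , eq
    ... | yes h≡0 with i , i<n , rest ← first-zero n h≡0 = i , ℕ.m<n⇒m<1+n i<n , rest

    H-descent : ∀ i → H I (suc i) ≡ 0 ⊎ H I (suc i) ℕ.+ i ≤ H I 1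
    H-descent zero    = inj₂ (ℕ.≤-reflexive (ℕ.+-identityʳ _))
    H-descent (suc i) with H-strict I (suc i) | H-descent i
    ... | inj₂ h≡0 | _         = inj₁ h≡0
    ... | inj₁ h<  | inj₁ h≡0  = contradiction (subst (H I (suc (suc i)) <_) h≡0 h<) λ ()
    ... | inj₁ h<  | inj₂ rest = inj₂ (ℕ.≤-trans (ℕ.≤-reflexive (ℕ.+-suc _ i)) (ℕ.≤-trans (ℕ.+-monoˡ-≤ i h<) rest))

    -- If all `a` columns were non-empty, their strict decrease would force the first to have size
    -- `a`.
    H-last : H I 1 < a → H I a ≡ 0
    H-last h<a with m , refl ← ℕ.m≤n⇒∃[o]m+o≡n (ℕ.≤-<-trans z≤n h<a) with H-descent m
    ... | inj₁ h≡0 = h≡0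
    ... | inj₂ le  = ℕ.n≤0⇒n≡0 (ℕ.+-cancelʳ-≤ m _ 0 (ℕ.s≤s⁻¹ (ℕ.≤-<-trans le h<a)))

  H₁-cases : ∀ I → H I 1 < a ⊎ H I 1 ≡ a
  H₁-cases I = ℕ.m≤n⇒m<n∨m≡n (H-bound I z≤n)

  module _ (I : Ideal) where
    open Sweep I

    s-shift : ∀ {j j′} → toℕ j′ ≡ suc (toℕ j) → s j′ sweep ≡ s j I
    s-shift {j} {j′} j′≡ = go (H₁-cases I) (find-size I v)
      where
      v = suc (toℕ j)
      v<a : v < a
      v<a = subst (_< a) j′≡ (Fin.toℕ<n j′)
      1≤a : 1 ≤ a
      1≤a = ℕ.≤-trans (s≤s z≤n) v<a
      present : ∀ {i} → i < a → H sweep (suc i) ≡ suc v → s j′ sweep ≡ 1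
      present i<a eq = s-present sweep i<a (trans eq (cong suc (sym j′≡)))
      absent : (∀ {i} → i < a → H sweep (suc i) ≢ suc v) → s j′ sweep ≡ 0
      absent none = s-absent sweep (λ i<a eq → none i<a (trans eq (cong suc j′≡)))
      go : H I 1 < a ⊎ H I 1 ≡ a →
           (∃[ i ] (i < a × H I (suc i) ≡ v)) ⊎ (∀ {i} → i < a → H I (suc i) ≢ v) → s j′ sweep ≡ s j I
      go (inj₁ h<a) (inj₁ (i , i<a , eq)) = trans
        (present i<a (trans (proj₁ (sweep-up h<a i<a) nonzero) (cong suc eq))) (sym (s-present I i<a eq))
        where
        nonzero : H I i ≢ 0
        nonzero h≡0 = contradiction (trans (sym eq) (H-zero h≡0)) λ ()
      go (inj₁ h<a) (inj₂ none) = trans (absent none′) (sym (s-absent I none))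
        where
        none′ : ∀ {i} → i < a → H sweep (suc i) ≢ suc v
        none′ {i} i<a eq with H I i ℕ.≟ 0
        ... | yes h≡0 = contradiction (trans (sym eq) (proj₂ (sweep-up h<a i<a) h≡0)) λ ()
        ... | no  h≢0 = none i<a (ℕ.suc-injective (trans (sym (proj₁ (sweep-up h<a i<a) h≢0)) eq))
      go (inj₂ h≡a) (inj₁ (zero  , _   , eq)) = contradiction (trans (sym eq) h≡a) (ℕ.<⇒≢ v<a)
      -- In a wrapping sweep the sizes move one column to the left while growing by one.
      go (inj₂ h≡a) (inj₁ (suc i , i<a , eq)) = trans
        (present (ℕ.<⇒≤ i<a) (trans (sweep-wrap 1≤a h≡a (ℕ.<⇒≤ i<a)) (cong least eq))) (sym (s-present I i<a eq))
      go (inj₂ h≡a) (inj₂ none) = trans (absent none′) (sym (s-absent I none))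
        where
        none′ : ∀ {i} → i < a → H sweep (suc i) ≢ suc v
        none′ {i} i<a eq with ℕ.m≤n⇒m<n∨m≡n i<a | least-suc⁻ (trans (sym (sweep-wrap 1≤a h≡a i<a)) eq)
        ... | inj₁ 1+i<a | h≡v = none 1+i<a h≡v
        ... | inj₂ 1+i≡a | h≡v = contradiction (trans (sym h≡v) (H-beyond I (ℕ.≤-reflexive (sym 1+i≡a)))) λ ()

    s-wrap : ∀ {j₀ j₁} → toℕ j₀ ≡ 0 → suc (toℕ j₁) ≡ a → s j₀ sweep ℕ.+ s j₁ I ≡ 1
    s-wrap {j₀} {j₁} j₀≡0 1+j₁≡a = Sum.[ inserted , removed ]′ (H₁-cases I)
      where
      inserted : H I 1 < a → s j₀ sweep ℕ.+ s j₁ I ≡ 1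
      inserted h<a = cong₂ ℕ._+_ (present (first-zero I a (H-last I h<a))) (s-absent I absent)
        where
        present : ∃[ i ] (i < a × H I i ≢ 0 × H I (suc i) ≡ 0) → s j₀ sweep ≡ 1
        present (i , i<a , h≢0 , h≡0) =
          s-present sweep i<a (trans (proj₁ (sweep-up h<a i<a) h≢0) (cong suc (trans h≡0 (sym j₀≡0))))
        absent : ∀ {i} → i < a → H I (suc i) ≢ suc (toℕ j₁)
        absent {zero}  _ eq = ℕ.<⇒≢ h<a (trans eq 1+j₁≡a)
        absent {suc i} _ eq with H-antitone I (suc (suc i)) (s≤s (s≤s z≤n))
        ... | inj₁ h≡0 = contradiction (trans (sym eq) h≡0) λ ()
        ... | inj₂ h<  = ℕ.<⇒≢ (ℕ.<-trans h< h<a) (trans eq 1+j₁≡a)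
      removed : H I 1 ≡ a → s j₀ sweep ℕ.+ s j₁ I ≡ 1
      removed h≡a = cong₂ ℕ._+_ (s-absent sweep absent) (s-present I 1≤a (trans h≡a (sym 1+j₁≡a)))
        where
        1≤a : 1 ≤ a
        1≤a = subst (1 ≤_) 1+j₁≡a (s≤s z≤n)
        absent : ∀ {i} → i < a → H sweep (suc i) ≢ suc (toℕ j₀)
        absent i<a eq = least≢1 _ (trans (sym (sweep-wrap 1≤a h≡a i<a)) (trans eq (cong suc j₀≡0)))

  -- Orbit sums under conjugation of words

  F : Finite Ideal
  F = J-finite (𝓛 a)

  orbitSum : List (Fin a) → (Ideal → ℕ) → Ideal → ℕ
  orbitSum w f I = ℕ.sum (map f (orbit F (word w) I))

  -- `column-sums` allows an arbitrary function `g` but only one column, because the time shift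
  -- caused by `φ` depends on the column. An expression that mixes columns has to be a sum over
  -- columns first.
  record Conjugates (v w : List (Fin a)) : Set where
    field
      φ           : Ideal ↔ Ideal
      intertwines : ∀ I → Inverse.to φ (Inverse.to (word v) I) ≡ Inverse.to (word w) (Inverse.to φ I)
      column-sums : ∀ (g : ℕ → ℕ) c I → orbitSum v (λ I′ → g (columnSize c (Inverse.to φ I′))) I ≡
                                        orbitSum v (λ I′ → g (columnSize c I′)) I

    s-sums : ∀ j I → orbitSum w (s j) (Inverse.to φ I) ≡ orbitSum v (s j) I
    s-sums j I = trans (Conjugate.orbit-sum F {word v} {word w} φ intertwines (s j) I) (go (allFin a))
      where
      k = suc (toℕ j)
      count : List (Fin a) → Ideal → ℕ
      count cs I = length (filter (λ c → columnSize c I ℕ.≟ k) cs)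
      open ≡-Reasoning
      O = orbit F (word v) I
      go : ∀ cs → ℕ.sum (map (count cs ∘ Inverse.to φ) O) ≡ ℕ.sum (map (count cs) O)
      go []       = refl
      go (c ∷ cs) = begin
        ℕ.sum (map (count (c ∷ cs) ∘ Inverse.to φ) O)
          ≡⟨ cong ℕ.sum (map-cong ((λ I → length-filter-≟ (λ c → columnSize c I) k c cs) ∘ Inverse.to φ) O) ⟩
        ℕ.sum (map (λ I → indicator k (columnSize c (Inverse.to φ I)) ℕ.+ count cs (Inverse.to φ I)) O)
          ≡⟨ sum-map-+ (λ I → indicator k (columnSize c (Inverse.to φ I))) (count cs ∘ Inverse.to φ) O ⟩
        ℕ.sum (map (λ I → indicator k (columnSize c (Inverse.to φ I))) O) ℕ.+ ℕ.sum (map (count cs ∘ Inverse.to φ) O)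
          ≡⟨ cong₂ ℕ._+_ (column-sums (indicator k) c I) (go cs) ⟩
        ℕ.sum (map (indicator k ∘ columnSize c) O) ℕ.+ ℕ.sum (map (count cs) O)
          ≡⟨ sum-map-+ (indicator k ∘ columnSize c) (count cs) O ⟨
        ℕ.sum (map (λ I → indicator k (columnSize c I) ℕ.+ count cs I) O)
          ≡⟨ cong ℕ.sum (map-cong (λ I → length-filter-≟ (λ c → columnSize c I) k c cs) O) ⟨
        ℕ.sum (map (count (c ∷ cs)) O) ∎

  step-conjugates : ∀ {v w} → Step v w → Conjugates v w
  step-conjugates {v} {w} (swap sw) = record
    { φ           = ↔-id Ideal
    ; intertwines = λ I → trans (word-act v I) (trans (act-swap sw I) (sym (word-act w I)))
    ; column-sums = λ g c I → refl
    }
  step-conjugates {c ∷ w} (rotate c∉w) = record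
    { φ           = φ
    ; intertwines = λ I → trans (to-φ _) (trans (cong (toggleColumn c) (trans (word-act (c ∷ w) I) (cong (act w) (sym (to-φ I)))))
                      (sym (trans (word-act (w ∷ʳ c) (Inverse.to φ I)) (act-∷ʳ w (Inverse.to φ I)))))
    ; column-sums = λ g d I → sums g d (d Fin.≟ c) I
    }
    where
    φ = σ-chain (𝓛 a) (column c)
    to-φ : ∀ I → Inverse.to φ I ≡ toggleColumn c I
    to-φ I = sym (toggleColumn≡to c I)
    -- Column c is untouched by the other letters, so in ideal number t of the
    -- image orbit it looks as in ideal number t + 1 of the original orbit.
    same-column : ∀ I → columnSize c (Inverse.to φ I) ≡ columnSize c (Inverse.to (word (c ∷ w)) I)
    same-column I = begin
      columnSize c (Inverse.to φ I)                  ≡⟨ columnSize≡H (Inverse.to φ I) c ⟩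
      H (Inverse.to φ I) (suc (toℕ c))               ≡⟨ cong (λ I → H I (suc (toℕ c))) (to-φ I) ⟩
      H (toggleColumn c I) (suc (toℕ c))             ≡⟨ act-rest w (toggleColumn c I) c∉w ⟨
      H (act (c ∷ w) I) (suc (toℕ c))                ≡⟨ cong (λ I → H I (suc (toℕ c))) (word-act (c ∷ w) I) ⟨
      H (Inverse.to (word (c ∷ w)) I) (suc (toℕ c))  ≡⟨ columnSize≡H (Inverse.to (word (c ∷ w)) I) c ⟨
      columnSize c (Inverse.to (word (c ∷ w)) I)     ∎
      where open ≡-Reasoning
    other-column : ∀ {d} → d ≢ c → ∀ I → columnSize d (Inverse.to φ I) ≡ columnSize d I
    other-column {d} d≢c I = begin
      columnSize d (Inverse.to φ I)       ≡⟨ columnSize≡H (Inverse.to φ I) d ⟩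
      H (Inverse.to φ I) (suc (toℕ d))    ≡⟨ cong (λ I → H I (suc (toℕ d))) (to-φ I) ⟩
      H (toggleColumn c I) (suc (toℕ d))  ≡⟨ H-toggle-rest c I (d≢c ∘ Fin.toℕ-injective ∘ ℕ.suc-injective) ⟩
      H I (suc (toℕ d))                   ≡⟨ columnSize≡H I d ⟨
      columnSize d I                      ∎
      where open ≡-Reasoning
    sums : ∀ (g : ℕ → ℕ) d → Dec (d ≡ c) → ∀ I →
           orbitSum (c ∷ w) (λ I′ → g (columnSize d (Inverse.to φ I′))) I ≡ orbitSum (c ∷ w) (λ I′ → g (columnSize d I′)) I
    sums g d (no d≢c)   I = cong ℕ.sum (map-cong (cong g ∘ other-column d≢c) (orbit F (word (c ∷ w)) I))
    sums g d (yes refl) I = trans (cong ℕ.sum (map-cong (cong g ∘ same-column) (orbit F (word (c ∷ w)) I)))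
                                  (orbit-sum-shift F (word (c ∷ w)) (g ∘ columnSize c) I)

-- From sums of natural numbers to averages of reals

ι : ℕ → ℚ
ι n = ℤ.+ n ℚ./ 1

-- `ℚ._/_` reduces fractions and is stuck on variables, so the identity is checked on unnormalised
-- rationals.
ι-+ : ∀ m n → ι (m ℕ.+ n) ≡ ι m ℚ.+ ι n
ι-+ m n = ℚ.toℚᵘ-injective (begin
  ℚ.toℚᵘ (ι (m ℕ.+ n))                              ≈⟨ ℚ.toℚᵘ-fromℚᵘ (ℚᵘ.mkℚᵘ (ℤ.+ (m ℕ.+ n)) 0) ⟩
  ℚᵘ.mkℚᵘ (ℤ.+ (m ℕ.+ n)) 0                         ≈⟨ ℚᵘ.*≡* (cong (ℤ._* ℤ.+ 1) (cong₂ ℤ._+_ (sym (ℤ.*-identityʳ (ℤ.+ m))) (sym (ℤ.*-identityʳ (ℤ.+ n))))) ⟩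
  ℚᵘ.mkℚᵘ (ℤ.+ m) 0 ℚᵘ.+ ℚᵘ.mkℚᵘ (ℤ.+ n) 0          ≈⟨ ℚᵘ.+-cong (ℚ.toℚᵘ-fromℚᵘ (ℚᵘ.mkℚᵘ (ℤ.+ m) 0)) (ℚ.toℚᵘ-fromℚᵘ (ℚᵘ.mkℚᵘ (ℤ.+ n) 0)) ⟨
  ℚ.toℚᵘ (ι m) ℚᵘ.+ ℚ.toℚᵘ (ι n)                    ≈⟨ ℚ.toℚᵘ-homo-+ (ι m) (ι n) ⟨
  ℚ.toℚᵘ (ι m ℚ.+ ι n)                              ∎)
  where open ℚᵘ.≃-Reasoning

1/n*n≡1 : ∀ k → (ℤ.+ 1 ℚ./ suc k) ℚ.* ι (suc k) ≡ 1ℚ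
1/n*n≡1 k = ℚ.toℚᵘ-injective (begin
  ℚ.toℚᵘ ((ℤ.+ 1 ℚ./ suc k) ℚ.* ι (suc k))                ≈⟨ ℚ.toℚᵘ-homo-* (ℤ.+ 1 ℚ./ suc k) (ι (suc k)) ⟩
  ℚ.toℚᵘ (ℤ.+ 1 ℚ./ suc k) ℚᵘ.* ℚ.toℚᵘ (ι (suc k))        ≈⟨ ℚᵘ.*-cong (ℚ.toℚᵘ-fromℚᵘ (ℚᵘ.mkℚᵘ (ℤ.+ 1) k)) (ℚ.toℚᵘ-fromℚᵘ (ℚᵘ.mkℚᵘ (ℤ.+ suc k) 0)) ⟩
  ℚᵘ.mkℚᵘ (ℤ.+ 1) k ℚᵘ.* ℚᵘ.mkℚᵘ (ℤ.+ suc k) 0            ≈⟨ ℚᵘ.*≡* (trans (ℤ.*-identityʳ (ℤ.+ 1 ℤ.* ℤ.+ suc k)) (cong (λ m → ℤ.+ 1 ℤ.* ℤ.+ m) (sym (ℕ.*-identityʳ (suc k))))) ⟩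
  ℚᵘ.1ℚᵘ                                                  ∎)
  where open ℚᵘ.≃-Reasoning

Σℚ : ∀ {X : Set} → (X → ℚ) → List X → ℚ
Σℚ f []       = 0ℚ
Σℚ f (x ∷ xs) = f x ℚ.+ Σℚ f xs

Σℚ-cong : ∀ {X : Set} {f g : X → ℚ} → (∀ x → f x ≡ g x) → ∀ xs → Σℚ f xs ≡ Σℚ g xs
Σℚ-cong f≗g []       = refl
Σℚ-cong f≗g (x ∷ xs) = cong₂ ℚ._+_ (f≗g x) (Σℚ-cong f≗g xs)

Σℚ-ι : ∀ {X : Set} (g : X → ℕ) xs → Σℚ (ι ∘ g) xs ≡ ι (ℕ.sum (map g xs))
Σℚ-ι g []       = refl
Σℚ-ι g (x ∷ xs) = trans (cong (ι (g x) ℚ.+_) (Σℚ-ι g xs)) (sym (ι-+ (g x) (ℕ.sum (map g xs))))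

-- Here r stands for the reciprocal of the length of xs.
module _ {X K : Set} (r : ℚ) (q : K → ℚ) (g : K → X → ℚ) (xs : List X)
         (half : ∀ k → r ℚ.* Σℚ (g k) xs ≡ ½) where

  average-combination : ∀ ks → r ℚ.* Σℚ (λ x → Σℚ (λ k → q k ℚ.* g k x) ks) xs ≡ Σℚ (λ k → q k ℚ.* ½) ks
  average-combination [] = trans (cong (r ℚ.*_) (zeros xs)) (ℚ.*-zeroʳ r)
    where
    zeros : ∀ xs → Σℚ (λ (_ : X) → 0ℚ) xs ≡ 0ℚ
    zeros []       = refl
    zeros (x ∷ xs) = trans (ℚ.+-identityˡ _) (zeros xs)
  average-combination (k ∷ ks) = begin
    r ℚ.* Σℚ (λ x → q k ℚ.* g k x ℚ.+ rest x) xs               ≡⟨ cong (r ℚ.*_) (split xs) ⟩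
    r ℚ.* (q k ℚ.* Σℚ (g k) xs ℚ.+ Σℚ rest xs)                 ≡⟨ distribute r (q k) (Σℚ (g k) xs) (Σℚ rest xs) ⟩
    q k ℚ.* (r ℚ.* Σℚ (g k) xs) ℚ.+ r ℚ.* Σℚ rest xs           ≡⟨ cong₂ ℚ._+_ (cong (q k ℚ.*_) (half k)) (average-combination ks) ⟩
    q k ℚ.* ½ ℚ.+ Σℚ (λ k → q k ℚ.* ½) ks                      ∎
    where
    open ≡-Reasoning
    rest : X → ℚ
    rest x = Σℚ (λ k → q k ℚ.* g k x) ks
    distribute : ∀ r q s t → r ℚ.* (q ℚ.* s ℚ.+ t) ≡ q ℚ.* (r ℚ.* s) ℚ.+ r ℚ.* t
    distribute = solve 4 (λ r q s t → r :* (q :* s :+ t) := q :* (r :* s) :+ r :* t) refl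
      where open +-*-Solver
    collect : ∀ q s t u v → (q ℚ.* s ℚ.+ t) ℚ.+ (q ℚ.* u ℚ.+ v) ≡ q ℚ.* (s ℚ.+ u) ℚ.+ (t ℚ.+ v)
    collect = solve 5 (λ q s t u v → (q :* s :+ t) :+ (q :* u :+ v) := q :* (s :+ u) :+ (t :+ v)) refl
      where open +-*-Solver
    split : ∀ xs → Σℚ (λ x → q k ℚ.* g k x ℚ.+ rest x) xs ≡ q k ℚ.* Σℚ (g k) xs ℚ.+ Σℚ rest xs
    split []       = sym (trans (ℚ.+-identityʳ _) (ℚ.*-zeroʳ (q k)))
    split (x ∷ xs) = trans (cong ((q k ℚ.* g k x ℚ.+ rest x) ℚ.+_) (split xs))
                           (collect (q k) (g k x) (rest x) (Σℚ (g k) xs) (Σℚ rest xs))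

half-of : ∀ r m n → r ℚ.* ι n ≡ 1ℚ → m ℕ.+ m ≡ n → r ℚ.* ι m ≡ ½
half-of r m n rn≡1 refl = begin
  r ℚ.* ι m                           ≡⟨ halve (r ℚ.* ι m) ⟩
  ½ ℚ.* (r ℚ.* ι m ℚ.+ r ℚ.* ι m)     ≡⟨ cong (½ ℚ.*_) (ℚ.*-distribˡ-+ r (ι m) (ι m)) ⟨
  ½ ℚ.* (r ℚ.* (ι m ℚ.+ ι m))         ≡⟨ cong (λ z → ½ ℚ.* (r ℚ.* z)) (ι-+ m m) ⟨
  ½ ℚ.* (r ℚ.* ι (m ℕ.+ m))           ≡⟨ cong (½ ℚ.*_) rn≡1 ⟩
  ½ ℚ.* 1ℚ                            ≡⟨ ℚ.*-identityʳ ½ ⟩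
  ½                                   ∎
  where
  open ≡-Reasoning
  halve : ∀ z → z ≡ ½ ℚ.* (z ℚ.+ z)
  halve z = sym (trans (ℚ.*-distribˡ-+ ½ z z) (trans (sym (ℚ.*-distribʳ-+ z ½ ½)) (ℚ.*-identityˡ z)))

seq-sum : ∀ {X : Set} (f : X → ℝ) xs n → ℝ.seq (sum (map f xs)) n ≡ Σℚ (λ x → ℝ.seq (f x) n) xs
seq-sum f []       n = refl
seq-sum f (x ∷ xs) n = cong (ℝ.seq (f x) n ℚ.+_) (seq-sum f xs n)

-- All operations on reals act termwise, so the identities needed hold term by term and no limit
-- argument arises.
≃-pointwise : ∀ {x y} → (∀ n → ℝ.seq x n ≡ ℝ.seq y n) → x ≃ y
≃-pointwise {x} {y} eq δ 0<δ = 0 , λ n _ →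
  subst (λ r → ℚ.∣ r ∣ ℚ.< δ) (sym (trans (cong (ℚ._- ℝ.seq y n) (eq n)) (ℚ.+-inverseʳ (ℝ.seq y n)))) 0<δ

-- The member `x` rules out the empty list. The reciprocal is abstracted to `r` because `average`
-- divides by the length of the mapped list, which is only propositionally `length xs`.
average-≃ : ∀ {X : Set} (f : X → ℝ) (c : ℝ) {x} xs → x ∈ xs →
  (∀ r → r ℚ.* ι (length xs) ≡ 1ℚ → ∀ n → r ℚ.* Σℚ (λ x → ℝ.seq (f x) n) xs ≡ ℝ.seq c n) →
  average (map f xs) ≃ c
average-≃ f c (y ∷ ys) _ eq = ≃-pointwise {average (map f (y ∷ ys))} {c} λ n →
  trans (cong (r ℚ.*_) (seq-sum f (y ∷ ys) n))
        (eq r (trans (cong (λ m → r ℚ.* ι (suc m)) (sym (length-map f ys))) (1/n*n≡1 (length (map f ys)))) n)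
  where
  r = ℤ.+ 1 ℚ./ suc (length (map f ys))

-- Transfer from the sweep to every comotion

module _ {a : ℕ} where
  open Words a

  -- The average 1/2 with denominators cleared; both sides are preserved along a conjugation.
  halfSums : List (Fin a) → Set
  halfSums w = ∀ j I → orbitSum w (s j) I ℕ.+ orbitSum w (s j) I ≡ length (orbit F (word w) I)

  halfSums-sorted : halfSums (allFin a)
  halfSums-sorted j I = begin
    -- All orbit sums agree, so the two copies may be taken at the smallest and the largest index,
    -- the pair related by `s-wrap`.
    S j ℕ.+ S j                                              ≡⟨ cong₂ ℕ._+_ (equal _ refl) (trans (equal _ refl) (sym (equal _ refl))) ⟩
    S j₀ ℕ.+ S j₁                                            ≡⟨ cong (ℕ._+ S j₁) (shifted j₀) ⟩
    ℕ.sum (map (s j₀ ∘ sweep) O) ℕ.+ ℕ.sum (map (s j₁) O)    ≡⟨ sum-map-+ (s j₀ ∘ sweep) (s j₁) O ⟨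
    ℕ.sum (map (λ I → s j₀ (sweep I) ℕ.+ s j₁ I) O)          ≡⟨ cong ℕ.sum (map-cong (λ I → s-wrap I (Fin.toℕ-fromℕ< 0<a) 1+j₁≡a) O) ⟩
    ℕ.sum (map (λ _ → 1) O)                                  ≡⟨ sum-map-1 O ⟩
    length O                                                 ∎
    where
    open ≡-Reasoning
    open Sweep using (sweep)
    O = orbit F (word (allFin a)) I
    S : Fin a → ℕ
    S j = orbitSum (allFin a) (s j) I
    0<a : 0 < a
    0<a = ℕ.≤-<-trans z≤n (Fin.toℕ<n j)
    pred<a : ℕ.pred a < a
    pred<a = ℕ.≤-reflexive (ℕ.suc-pred a {{ℕ.>-nonZero 0<a}})
    j₀ = fromℕ< 0<a
    j₁ = fromℕ< pred<a
    1+j₁≡a : suc (toℕ j₁) ≡ a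
    1+j₁≡a = trans (cong suc (Fin.toℕ-fromℕ< pred<a)) (ℕ.suc-pred a {{ℕ.>-nonZero 0<a}})
    shifted : ∀ j → S j ≡ ℕ.sum (map (s j ∘ sweep) O)
    shifted j = trans (sym (orbit-sum-shift F (word (allFin a)) (s j) I))
                      (cong ℕ.sum (map-cong (λ I → cong (s j) (word-act (allFin a) I)) O))
    -- Applying the sweep permutes the orbit and lowers the index by one, so induction ends at `j₀`.
    equal : ∀ n {j} → toℕ j ≡ n → S j ≡ S j₀
    equal zero    j≡0 = cong S (Fin.toℕ-injective (trans j≡0 (sym (Fin.toℕ-fromℕ< 0<a))))
    equal (suc n) {j} j≡1+n = trans (shifted j) (trans
      (cong ℕ.sum (map-cong (λ I → s-shift I (trans j≡1+n (cong suc (sym (Fin.toℕ-fromℕ< n<a))))) O))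
      (equal n (Fin.toℕ-fromℕ< n<a)))
      where
      n<a : n < a
      n<a = ℕ.<-trans (ℕ.n<1+n n) (subst (_< a) j≡1+n (Fin.toℕ<n j))

  halfSums-steps : ∀ {w} → Star Step w (allFin a) → halfSums w
  halfSums-steps ε = halfSums-sorted
  halfSums-steps {w} (_◅_ {j = w′} st sts) j I = begin
    orbitSum w (s j) I ℕ.+ orbitSum w (s j) I                    ≡⟨ cong₂ ℕ._+_ (s-sums j I) (s-sums j I) ⟨
    orbitSum w′ (s j) (to I) ℕ.+ orbitSum w′ (s j) (to I)        ≡⟨ halfSums-steps sts j (to I) ⟩
    length (orbit F (word w′) (to I))                            ≡⟨ Conjugate.orbit-length F {word w} {word w′} φ intertwines I ⟨
    length (orbit F (word w) I)                                  ∎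
    where
    open ≡-Reasoning
    open Conjugates (step-conjugates st)
    to = Inverse.to φ

  orbitSizes-steps : ∀ {w} → Star Step w (allFin a) → orbitSizes F (word w) ↭ orbitSizes F (word (allFin a))
  orbitSizes-steps ε = ↭-refl
  orbitSizes-steps {w} (_◅_ {j = w′} st sts) =
    ↭-trans (Conjugate.orbitSizes-conjugate F {word w} {word w′} φ intertwines) (orbitSizes-steps sts)
    where open Conjugates (step-conjugates st)

  letters : Permutation′ a → List (Fin a)
  letters ν = map (ν ⟨$⟩ʳ_) (allFin a)

  sort-letters : ∀ ν → Star Step (letters ν) (allFin a)
  sort-letters ν = sort-by-steps (AllPairs.tabulate⁺-< id)
    (unique-↭ (Unique.map⁺ (Injection.injective (↔⇒↣ ν)) (Unique.allFin⁺ a)) (Unique.allFin⁺ a)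
      (λ {x} _ → ∈-allFin x)
      (λ {y} _ → subst (_∈ letters ν) (inverseʳ ν) (∈-map⁺ (ν ⟨$⟩ʳ_) (∈-allFin (ν ⟨$⟩ˡ y)))))

  halfSum-comotion : ∀ ν j I → let O = orbit F (comotion ν) I in
                     ℕ.sum (map (s j) O) ℕ.+ ℕ.sum (map (s j) O) ≡ length O
  halfSum-comotion ν j I = subst (λ τ → let O = orbit F τ I in ℕ.sum (map (s j) O) ℕ.+ ℕ.sum (map (s j) O) ≡ length O)
    (sym (comotion≡word ν)) (halfSums-steps (sort-letters ν) j I)

  orbitSizes-comotion : ∀ ν → orbitSizes F (comotion ν) ↭ orbitSizes F (word (allFin a))
  orbitSizes-comotion ν = subst (λ τ → orbitSizes F τ ↭ orbitSizes F (word (allFin a)))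
    (sym (comotion≡word ν)) (orbitSizes-steps (sort-letters ν))

  reciprocal-sum : ∀ ν I r → r ℚ.* ι (length (orbit F (comotion ν) I)) ≡ 1ℚ →
                   ∀ j → r ℚ.* Σℚ (ι ∘ s j) (orbit F (comotion ν) I) ≡ ½
  reciprocal-sum ν I r r≡ j = trans (cong (r ℚ.*_) (Σℚ-ι (s j) (orbit F (comotion ν) I)))
    (half-of r (ℕ.sum (map (s j) (orbit F (comotion ν) I))) (length (orbit F (comotion ν) I)) r≡ (halfSum-comotion ν j I))

  s-homomesic : ∀ ν j → HomomesicWith F (comotion ν) (λ I → fromℕ (s j I)) (fromℚ ½)
  s-homomesic ν j I = average-≃ (λ I → fromℕ (s j I)) (fromℚ ½) (orbit F (comotion ν) I)
    (Orbit.orbit-refl F (comotion ν)) (λ r r≡ _ → reciprocal-sum ν I r r≡ j)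

  combination-homomesic : ∀ ν (c : Fin a → ℝ) →
    HomomesicWith F (comotion ν) (linearCombination c) (sum (map (λ j → c j * fromℚ ½) (allFin a)))
  combination-homomesic ν c I = average-≃ (linearCombination c) (sum (map (λ j → c j * fromℚ ½) (allFin a)))
    (orbit F (comotion ν) I) (Orbit.orbit-refl F (comotion ν)) λ r r≡ n → begin
      r ℚ.* Σℚ (λ I → ℝ.seq (linearCombination c I) n) O
        ≡⟨ cong (r ℚ.*_) (Σℚ-cong (λ I → seq-sum (λ j → c j * fromℕ (s j I)) (allFin a) n) O) ⟩
      r ℚ.* Σℚ (λ I → Σℚ (λ j → ℝ.seq (c j) n ℚ.* ι (s j I)) (allFin a)) O
        ≡⟨ average-combination r (λ j → ℝ.seq (c j) n) (λ j → ι ∘ s j) O (reciprocal-sum ν I r r≡) (allFin a) ⟩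
      Σℚ (λ j → ℝ.seq (c j) n ℚ.* ½) (allFin a)
        ≡⟨ seq-sum (λ j → c j * fromℚ ½) (allFin a) n ⟨
      ℝ.seq (sum (map (λ j → c j * fromℚ ½) (allFin a))) n ∎
    where
    open ≡-Reasoning
    O = orbit F (comotion ν) I

mainTheorem3 : (a : ℕ) → 1 ≤ a →
    ((ν ν′ : Permutation′ a) →
    orbitSizes (J-finite (𝓛 a)) (comotion ν) ↭ orbitSizes (J-finite (𝓛 a)) (comotion ν′))
    × ((ν : Permutation′ a) →
    ((j : Fin a) → HomomesicWith (J-finite (𝓛 a)) (comotion ν) (λ I → fromℕ (s j I)) (fromℚ ½))
    × ((c : Fin a → ℝ) → Homomesic (J-finite (𝓛 a)) (comotion ν) (linearCombination c)))
mainTheorem3 a _ =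
  (λ ν ν′ → ↭-trans (orbitSizes-comotion ν) (↭-sym (orbitSizes-comotion ν′))) ,
  λ ν → s-homomesic ν , λ c → sum (map (λ j → c j * fromℚ ½) (allFin a)) , combination-homomesic ν c
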